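{- For all integers $g\ge1$ and $n\ge1$, the application $\Lambda$ defines a bijection $$\Lambda:\ \biguplus_{p=0}^{g-1}\mathcal{U}^{2g-2p+1}_p(n)\longrightarrow\mathcal{D}_g(n).$$
   Context: A unicellular map with $n$ edges is a triple $\mathfrak{m}=(H,\alpha,\sigma)$ with $|H|=2n$ (half-edges), $\alpha$ a fixed-point-free involution of $H$, $\sigma$ a permutation of $H$ such that $\gamma=\alpha\sigma$ ($\gamma(h)=\alpha(\sigma(h))$) is a single cycle; cycles of $\sigma$ are vertices. Maps are rooted at a half-edge $r$, and two rooted maps are identified if a bijection of half-edge sets sends root to root and conjugates $\alpha,\sigma$ to their counterparts. The genus $g$ is given by $v=n+1-2g$ ($v$ = number of vertices). The total order $<_{\mathfrak{m}}$ on $H$ is $r<_{\mathfrak{m}}\gamma(r)<_{\mathfrak{m}}\dots<_{\mathfrak{m}}\gamma^{2n-1}(r)$; $\min_{\mathfrak{m}}(v)$ is the minimal half-edge of vertex $v$, $V(h)$ the vertex containing $h$; for vertices we write $v<_{\mathfrak{m}}w$ for $\min_{\mathfrak{m}}v<_{\mathfrak{m}}\min_{\mathfrak{m}}w$. A trisection is a half-edge $h$ with $\sigma(h)\le_{\mathfrak{m}}h$ and $\sigma(h)\ne\min_{\mathfrak{m}}V(h)$. $\mathcal{U}^k_p(n)$ is the set of rooted unicellular maps of genus $p$ with $n$ edges and a set of $k$ distinct distinguished vertices; $\mathcal{D}_g(n)$ is the set of rooted unicellular maps of genus $g$ with $n$ edges and a distinguished trisection. Gluing: given $a_1<_{\mathfrak{m}}a_2<_{\mathfrak{m}}a_3$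 in three distinct vertices $v_i=(a_i,h_i^1,\dots,h_i^{m_i})$, the glued map is $(H,\alpha,\bar\sigma)$ (same root), $\bar\sigma$ obtained from $\sigma$ by replacing $v_1,v_2,v_3$ with the cycle $(a_1,h_2^1,\dots,h_2^{m_2},a_2,h_3^1,\dots,h_3^{m_3},a_3,h_1^1,\dots,h_1^{m_1})$. $\Phi$: for three distinct vertices $v_1<_{\mathfrak{m}}v_2<_{\mathfrak{m}}v_3$ with $a_i=\min_{\mathfrak{m}}v_i$, $\Phi(\mathfrak{m},v_1,v_2,v_3)=(\bar{\mathfrak{m}},\tau)$ where $\bar{\mathfrak{m}}=(H,\alpha,\bar\sigma)$ is the gluing at $a_1,a_2,a_3$ and $\tau=\bar\sigma^{ -1}(a_3)$. $\Psi$: for vertices $v_1,v_2$ and a trisection $\tau$ of $\mathfrak{m}$ with $v_1<_{\mathfrak{m}}v_2<_{\mathfrak{m}}V(\tau)$, $\Psi(\mathfrak{m},v_1,v_2,\tau)=(\bar{\mathfrak{m}},\tau)$ where $\bar{\mathfrak{m}}$ is the gluing at $\min_{\mathfrak{m}}v_1,\min_{\mathfrak{m}}v_2,\sigma(\tau)$. $\Lambda$: given $q\ge1$ and $(\mathfrak{m},v_1,\dots,v_{2q+1})\in\mathcal{U}^{2q+1}_p(n)$ with vertices numbered so that $v_1<_{\mathfrak{m}}v_2<_{\mathfrak{m}}\dots<_{\mathfrak{m}}v_{2q+1}$: (i) let $(\mathfrak{m}_1,\tau)=\Phi(\mathfrak{m},v_{2q-1},v_{2q},v_{2q+1})$; (ii)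 for $i=1,\dots,q-1$, let $(\mathfrak{m}_{i+1},\tau)=\Psi(\mathfrak{m}_i,v_{2q-2i-1},v_{2q-2i},\tau)$. Then $\Lambda(\mathfrak{m},v_1,\dots,v_{2q+1})=(\mathfrak{m}_q,\tau)$. -}

module Defs where

open import Data.Nat using (ℕ; zero; suc; _+_; _*_; _∸_; _≡ᵇ_; _<ᵇ_; _≤ᵇ_)
open import Data.Nat.DivMod using (_%_; m%n<n)
open import Data.Fin using (Fin; zero; suc; toℕ; fromℕ<)
open import Data.Fin.Properties using () renaming (_≟_ to _≟F_)
open import Data.Bool using (Bool; true; false; _∧_; not; if_then_else_; T)
open import Data.List using (List; []; _∷_; foldr; allFin; upTo; map; reverse)
open import Data.Bool.ListAction using (all)
open import Data.Nat.ListAction using (sum)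
open import Data.Vec using (Vec; lookup; tabulate; toList)
open import Data.Product using (Σ; _×_; _,_)
open import Relation.Nullary.Decidable using (⌊_⌋)

-- Half-edges of a map with n edges: Fin (2 * n).
-- A rooted unicellular map is represented canonically:
-- half-edges are labelled by their position along the unique face,
-- starting at the root 0, so γ(h) = h + 1 mod 2n, the order <_m is the
-- order of Fin, and the map is determined by α (a fixed-point-free
-- involution), with σ = α ∘ γ (so that γ = α σ).

HE : ℕ → Set
HE n = Fin (2 * n)

-- α stored as a table, so that propositional equality is meaningful
record Chord (n : ℕ) : Set where
  constructor chord
  field tbl : Vec (HE n) (2 * n)

ap : ∀ {n} → Chord n → HE n → HE n
ap α = lookup (Chord.tbl α)

_==_ : ∀ {N} → Fin N → Fin N → Bool
i == j = ⌊ i ≟F j ⌋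

allB : ∀ {N} → (Fin N → Bool) → Bool
allB {N} P = all P (allFin N)

countB : ∀ {N} → (Fin N → Bool) → ℕ
countB {N} P = sum (map (λ h → if P h then 1 else 0) (allFin N))

iter : ∀ {A : Set} → (A → A) → ℕ → A → A
iter f zero x = x
iter f (suc k) x = f (iter f k x)

-- successor modulo N (the face permutation γ of a canonical map)
next : ∀ {N} → Fin N → Fin N
next {suc N} i = fromℕ< (m%n<n (suc (toℕ i)) (suc N))

isChord : ∀ {n} → Chord n → Bool
isChord α = allB (λ i → (ap α (ap α i) == i) ∧ not (ap α i == i))

σc : ∀ {n} → Chord n → HE n → HE n
σc α h = ap α (next h)

vmin : ∀ {N} → (Fin N → ℕ) → (Fin N → Fin N) → Fin N → Fin N
vmin {N} key s h =
  foldr (λ y acc → if key y <ᵇ key acc then y else acc) h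
        (map (λ i → iter s i h) (upTo N))

posF : ∀ {N} → (Fin N → Fin N) → Fin N → Fin N → Fin N
posF {N} γ r h = foldr (λ k acc → if iter γ (toℕ k) r == h then k else acc) r (allFin N)

-- the order <_m of the map (α, σ) rooted at r, as a key
key : ∀ {N} → (Fin N → Fin N) → (Fin N → Fin N) → Fin N → Fin N → ℕ
key α s r h = toℕ (posF (λ x → α (s x)) r h)

preim : ∀ {N} → (Fin N → Fin N) → Fin N → Fin N
preim {N} s c = foldr (λ h acc → if s h == c then h else acc) c (allFin N)

-- gluing at a1, a2, a3 : the new cycle (a1, h2.., a2, h3.., a3, h1..)
glue : ∀ {N} → (Fin N → Fin N) → Fin N → Fin N → Fin N → Fin N → Fin N
glue s a1 a2 a3 h =
  if h == a1 then s a2 else if h == a2 then s a3 else if h == a3 then s a1 else s h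

-- relabel the rooted map (α, σ, r) canonically along its face γ = α σ
canon : ∀ {n} → (HE n → HE n) → (HE n → HE n) → HE n → Chord n
canon {n} α s r = chord (tabulate (λ k → posF γ r (α (iter γ (toℕ k) r))))
  where γ = λ x → α (s x)

isVMin : ∀ {n} → Chord n → HE n → Bool
isVMin α h = vmin toℕ (σc α) h == h

numVertices : ∀ {n} → Chord n → ℕ
numVertices α = countB (isVMin α)

hasGenus : ∀ {n} → Chord n → ℕ → Bool
hasGenus {n} α p = (numVertices α + 2 * p) ≡ᵇ (n + 1)

strictlySorted : ∀ {N} → List (Fin N) → Bool
strictlySorted (x ∷ y ∷ t) = (toℕ x <ᵇ toℕ y) ∧ strictlySorted (y ∷ t)
strictlySorted _ = true

isTrisection : ∀ {n} → Chord n → HE n → Bool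
isTrisection α h =
  (toℕ (σc α h) ≤ᵇ toℕ h) ∧ not (σc α h == vmin toℕ (σc α) h)

-- U^k_p(n): rooted unicellular maps of genus p with n edges and a set of k
-- distinct distinguished vertices (each vertex given by its minimal half-edge,
-- the set listed in increasing order)
U : ℕ → ℕ → ℕ → Set
U k p n = Σ (Chord n) λ α → Σ (Vec (HE n) k) λ ws →
  T (isChord α ∧ hasGenus α p ∧ all (isVMin α) (toList ws) ∧ strictlySorted (toList ws))

IsD : (g n : ℕ) → Chord n × HE n → Set
IsD g n (α , τ) = T (isChord α ∧ hasGenus α g ∧ isTrisection α τ)

D : ℕ → ℕ → Set
D g n = Σ (Chord n × HE n) (IsD g n)

Dom : ℕ → ℕ → Set
Dom g n = Σ (Fin g) λ p → U (suc (2 * (g ∸ toℕ p))) (toℕ p) n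

zeroOf : ∀ {N} → Fin N → Fin N
zeroOf {suc _} _ = zero

-- (x ∷ y ∷ t) ↦ (y , x) ∷ ...   (input: remaining vertices in decreasing order)
revPairs : ∀ {A : Set} → List A → List (A × A)
revPairs (x ∷ y ∷ t) = (y , x) ∷ revPairs t
revPairs _ = []

ΨLoop : ∀ {N} → (Fin N → Fin N) → Fin N → (Fin N → Fin N) → Fin N →
        List (Fin N × Fin N) → (Fin N → Fin N) × Fin N
ΨLoop α r s τ [] = s , τ
ΨLoop α r s τ ((v1 , v2) ∷ ps) =
  ΨLoop α r (glue s (vmin (key α s r) s v1) (vmin (key α s r) s v2) (s τ)) τ ps

-- Λ on raw data: α, vertices w1 < ... < wk (as half-edges of those vertices)
ΛRaw : ∀ {n k} → Chord n → Vec (HE n) (suc k) → Chord n × HE n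
ΛRaw {n} α ws with reverse (toList ws)
... | c ∷ b ∷ a ∷ rest =
  let r  = zeroOf c
      αf = ap α
      s0 = σc α
      -- (i) Φ(m, v_{2q-1}, v_{2q}, v_{2q+1})
      s1 = glue s0 (vmin (key αf s0 r) s0 a) (vmin (key αf s0 r) s0 b)
                   (vmin (key αf s0 r) s0 c)
      τ1 = preim s1 (vmin (key αf s0 r) s0 c)
      res = ΨLoop αf r s1 τ1 (revPairs rest)
      sq = Data.Product.proj₁ res
      τq = Data.Product.proj₂ res
  in canon αf sq r , posF (λ x → αf (sq x)) r τq
... | _ = α , zeroOf (lookup ws zero)

Λ : ∀ g n → Dom g n → Chord n × HE n
Λ g n (p , α , ws , _) = ΛRaw α ws

{-# OPTIONS --safe #-}
-- Gluing at a₁ < a₂ < a₃ replaces γ by γ ∘ (a₁ a₂ a₃), so in canonical labels it merely exchanges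
-- the consecutive intervals (a₁ , a₂] and (a₂ , a₃] of the face, and it is undone by exchanging
-- them back.  Every step of Λ is such an exchange with the same a₃ = c, where a₁ and a₂ are the
-- minima of two vertices lying below all of V(c).  After the exchange a₁ is the minimum of V(c),
-- c is no longer a minimum, and a₂ is the smallest half-edge exceeding c met when turning around
-- the vertex from a₁ to c.  These recipes recover the step from its result.  Conversely, they can
-- be applied whenever c is entered by a descent and is not a minimum.  Each application produces
-- two more vertices, of which there are at most n + 1 since σ has n + 1 descents, so slicing stops;
-- it stops exactly when c has become a vertex minimum, the last of the distinguished vertices.
module Submission where

open import Defs
open import Data.Bool using (Bool; true; false; _∧_; not; if_then_else_; T)
open import Data.Bool.ListAction using (all)
open import Data.Bool.Properties using (T-∧; T-irrelevant)
open import Data.Empty using (⊥-elim)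
open import Data.Fin using (Fin; zero; suc; toℕ; fromℕ<)
open import Data.Fin.Properties using (_≟_; toℕ-injective; toℕ<n; toℕ-fromℕ<; pigeonhole)
open import Data.List as List using (List; []; _∷_; foldr; length; allFin; upTo; map; reverse)
open import Data.List.Membership.Propositional using (_∈_)
open import Data.List.Membership.Propositional.Properties using (∈-allFin; ∈-upTo⁺; ∈-map⁺; ∈-map⁻)
open import Data.List.Properties using (map-tabulate; unfold-reverse; reverse-involutive; reverse-injective; length-reverse; ∷-injective)
open import Data.List.Relation.Unary.All as All using (All; []; _∷_)
open import Data.List.Relation.Unary.All.Properties using (all⁺; all⁻)
open import Data.List.Relation.Unary.AllPairs using (AllPairs; []; _∷_)
import Data.List.Relation.Unary.AllPairs.Properties as AllPairs
open import Data.List.Relation.Unary.Any using (here; there)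
open import Data.List.Relation.Unary.Any.Properties using (reverse⁻)
open import Data.List.Relation.Unary.Linked using (Linked; []; [-]; _∷_)
open import Data.List.Relation.Unary.Linked.Properties using (Linked⇒AllPairs; AllPairs⇒Linked)
open import Data.Nat using (ℕ; zero; suc; _+_; _*_; _∸_; _≤_; _<_; z≤n; s≤s; _<ᵇ_; _≤ᵇ_; _≤?_; _<?_)
open import Data.Nat.DivMod using (m<n⇒m%n≡m; n%n≡0; m%n<n)
open import Data.Nat.ListAction using () renaming (sum to sumL)
open import Data.Nat.Properties hiding (_≟_)
open import Algebra.Properties.CommutativeMonoid.Sum +-0-commutativeMonoid using (sum; ∑-comm; ∑-distrib-+; sum-cong-≗)
open import Data.Product using (Σ; ∃; _×_; _,_; proj₁; proj₂)
open import Data.Sum as Sum using (_⊎_; inj₁; inj₂)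
open import Data.Vec using (Vec; lookup; tabulate; toList; fromList)
open import Data.Vec.Properties using (lookup∘tabulate; tabulate∘lookup; tabulate-cong; toList-injective; cast-is-id; length-toList; toList∘fromList)
open import Function using (_∘_; id; flip)
open import Function.Bundles using (Equivalence)
open import Function.Definitions using (Injective; Bijective)
open import Relation.Binary.PropositionalEquality
open import Relation.Nullary using (¬_; Dec; yes; no; contradiction)
import Relation.Nullary.Decidable as Dec

-- One calculation serves both directions. A block exchange and its inverse rewire three half-edges
-- by formulas of the same shape; only the distribution of these half-edges, over three vertices or
-- along one, makes the exchange a merging or a splitting. Φ and Ψ are not separated either: a
-- vertex minimum is entered by a descent, just as `σ(τ)` is for a trisection `τ`, so both are steps
-- of one kind. Since the source is a union over p, chains of different lengths that end alike must
-- be compared. Steps are deterministic backwards, so one chain is a tail of the other, and a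
-- minimum `c` cannot occur after a step. A further obstacle is that Λ keeps the names of half-edges
-- and changes σ, while the steps keep the face standard and rename. A bijection from names to
-- positions links the two; half-edges still to be glued lie below every exchange, so their name
-- remains their position.

private variable
  E : Set
  N n : ℕ

-- Boolean tests and the propositions they decide

T-ext : {a b : Bool} → (T a → T b) → (T b → T a) → a ≡ b
T-ext {true} {true} _ _ = refl
T-ext {true} {false} f _ = ⊥-elim (f _)
T-ext {false} {true} _ g = ⊥-elim (g _)
T-ext {false} {false} _ _ = refl

==⇒≡ : (i j : Fin N) → T (i == j) → i ≡ j
==⇒≡ _ _ = Dec.toWitness

≡⇒== : {i j : Fin N} → i ≡ j → T (i == j)
≡⇒== = Dec.fromWitness

==-refl : (i : Fin N) → (i == i) ≡ true
==-refl i = T-ext _ (λ _ → ≡⇒== {i = i} refl)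

≢⇒==false : {i j : Fin N} → i ≢ j → (i == j) ≡ false
≢⇒==false ne = T-ext (λ t → ne (==⇒≡ _ _ t)) λ ()

not-T : {b : Bool} → ¬ T b → T (not b)
not-T {true} f = f _
not-T {false} _ = _

T-not : {b : Bool} → T (not b) → ¬ T b
T-not {false} _ ()

∧-intro : {a b : Bool} → T a → T b → T (a ∧ b)
∧-intro x y = Equivalence.from T-∧ (x , y)

∧-elim : (a : Bool) {b : Bool} → T (a ∧ b) → T a × T b
∧-elim _ = Equivalence.to T-∧

-- Iterates and orbits

iter-+ : (f : E → E) (m k : ℕ) (x : E) → iter f (m + k) x ≡ iter f m (iter f k x)
iter-+ f zero k x = refl
iter-+ f (suc m) k x = cong f (iter-+ f m k x)

iter-shift : (f : E → E) (k : ℕ) (x : E) → iter f k (f x) ≡ f (iter f k x)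
iter-shift f zero x = refl
iter-shift f (suc k) x = cong f (iter-shift f k x)

iter-injective : {f : E → E} → Injective _≡_ _≡_ f → ∀ k → Injective _≡_ _≡_ (iter f k)
iter-injective inj zero eq = eq
iter-injective inj (suc k) eq = iter-injective inj k (inj eq)

iter-invariant : (P : E → Set) {f : E → E} → (∀ {x} → P x → P (f x)) →
                 ∀ k {x} → P x → P (iter f k x)
iter-invariant P step zero px = px
iter-invariant P step (suc k) px = step (iter-invariant P step k px)

Reach : (E → E) → E → E → Set
Reach f x y = ∃ λ k → iter f k x ≡ y

reach-refl : {f : E → E} {x : E} → Reach f x x
reach-refl = 0 , refl

reach-trans : {f : E → E} {x y z : E} → Reach f x y → Reach f y z → Reach f x z
reach-trans {f = f} {x} (k , refl) (l , refl) = l + k , iter-+ f l k x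

reach-suc : {f : E → E} {x y : E} → Reach f x y → Reach f x (f y)
reach-suc (k , refl) = suc k , refl

reach-invariant : (P : E → Set) {f : E → E} → (∀ {x} → P x → P (f x)) →
                  ∀ {x y} → Reach f x y → P x → P y
reach-invariant P step (k , refl) = iter-invariant P step k

module Orbit {s : Fin N → Fin N} (inj : Injective _≡_ _≡_ s) where

  -- Two of the `N + 1` iterates with exponents `0` to `N` coincide, and injectivity cancels their
  -- common part. The bound matters because `vmin` inspects only `N` iterates.
  period : ∀ x → ∃ λ m → suc m ≤ N × iter s (suc m) x ≡ x
  period x with pigeonhole (n<1+n N) (λ i → iter s (toℕ i) x)
  ... | i , j , i<j , eq with m<n⇒0<n∸m i<j
  ... | pos with toℕ j ∸ toℕ i in deq
  ... | suc m = m , sm≤N , iter-injective inj (toℕ i) (begin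
      iter s (toℕ i) (iter s (suc m) x) ≡⟨ iter-+ s (toℕ i) (suc m) x ⟨
      iter s (toℕ i + suc m) x          ≡⟨ cong (λ k → iter s k x) ij ⟩
      iter s (toℕ j) x                  ≡⟨ eq ⟨
      iter s (toℕ i) x                  ∎)
    where
    open ≡-Reasoning
    ij : toℕ i + suc m ≡ toℕ j
    ij = trans (cong (toℕ i +_) (sym deq)) (m+[n∸m]≡n (<⇒≤ i<j))
    sm≤N : suc m ≤ N
    sm≤N = ≤-trans (m≤n+m (suc m) (toℕ i)) (≤-trans (≤-reflexive ij) (≤-pred (toℕ<n j)))

  reduce : ∀ x k → let P = suc (proj₁ (period x)) in ∃ λ i → i < P × iter s i x ≡ iter s k x
  reduce x zero = 0 , s≤s z≤n , refl
  reduce x (suc k) with reduce x k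
  ... | i , i<P , eq with suc i <? suc (proj₁ (period x))
  ... | yes p = suc i , p , cong s eq
  ... | no ¬p with ≤-antisym i<P (≮⇒≥ ¬p)
  ... | refl = 0 , s≤s z≤n , trans (sym (proj₂ (proj₂ (period x)))) (cong s eq)

  reach-sym : ∀ {x y} → Reach s x y → Reach s y x
  reach-sym {x} {y} (k , refl) with reduce x k
  ... | i , i<P , eq = P ∸ i , (begin
      iter s (P ∸ i) (iter s k x) ≡⟨ cong (iter s (P ∸ i)) eq ⟨
      iter s (P ∸ i) (iter s i x) ≡⟨ iter-+ s (P ∸ i) i x ⟨
      iter s (P ∸ i + i) x        ≡⟨ cong (λ k → iter s k x) (m∸n+n≡m (<⇒≤ i<P)) ⟩
      iter s P x                  ≡⟨ proj₂ (proj₂ (period x)) ⟩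
      x                           ∎)
    where
    open ≡-Reasoning
    P = suc (proj₁ (period x))

  preimage : ∀ x → ∃ λ y → s y ≡ x
  preimage x = iter s (proj₁ (period x)) x , proj₂ (proj₂ (period x))

-- Vertex minima

Min : (Fin N → Fin N) → Fin N → Set
Min s h = ∀ {y} → Reach s h y → toℕ h ≤ toℕ y

module _ (key : E → ℕ) where

  pick : E → E → E
  pick y acc = if key y <ᵇ key acc then y else acc

  pick-≤ˡ : ∀ y acc → key (pick y acc) ≤ key y
  pick-≤ˡ y acc with key y <ᵇ key acc in eq
  ... | true = ≤-refl
  ... | false = ≮⇒≥ λ lt → subst T eq (<⇒<ᵇ lt)

  pick-≤ʳ : ∀ y acc → key (pick y acc) ≤ key acc
  pick-≤ʳ y acc with key y <ᵇ key acc in eq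
  ... | true = <⇒≤ (<ᵇ⇒< _ _ (subst T (sym eq) _))
  ... | false = ≤-refl

  pick-either : ∀ y acc → (pick y acc ≡ y) ⊎ (pick y acc ≡ acc)
  pick-either y acc with key y <ᵇ key acc
  ... | true = inj₁ refl
  ... | false = inj₂ refl

  foldr-pick-≤ : ∀ h xs {y} → y ∈ xs → key (foldr pick h xs) ≤ key y
  foldr-pick-≤ h (x ∷ xs) (here refl) = pick-≤ˡ x _
  foldr-pick-≤ h (x ∷ xs) (there m) = ≤-trans (pick-≤ʳ x _) (foldr-pick-≤ h xs m)

  foldr-pick-∈ : ∀ h xs → foldr pick h xs ∈ (h ∷ xs)
  foldr-pick-∈ h [] = here refl
  foldr-pick-∈ h (x ∷ xs) with pick-either x (foldr pick h xs) | foldr-pick-∈ h xs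
  ... | inj₁ e | _ = there (here e)
  ... | inj₂ e | here e′ = here (trans e e′)
  ... | inj₂ e | there m = there (there (subst (_∈ xs) (sym e) m))

  foldr-pick-fix : ∀ h xs → (∀ {y} → y ∈ xs → key h ≤ key y) → foldr pick h xs ≡ h
  foldr-pick-fix h [] f = refl
  foldr-pick-fix h (x ∷ xs) f rewrite foldr-pick-fix h xs (f ∘ there)
    with key x <ᵇ key h in eq
  ... | true = contradiction (<ᵇ⇒< _ _ (subst T (sym eq) _)) (≤⇒≯ (f (here refl)))
  ... | false = refl

-- The key is arbitrary because Λ also takes minima in the face order of maps that are not
-- canonically labelled. The comparison in `vmin` is strict, so ties never displace `h`.
vmin-fix : (key : Fin N → ℕ) (s : Fin N → Fin N) (h : Fin N) →
           (∀ {y} → Reach s h y → key h ≤ key y) → vmin key s h ≡ h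
vmin-fix {N} key s h f = foldr-pick-fix key h _ λ m → case (∈-map⁻ _ m)
  where
  case : ∀ {y} → ∃ (λ i → i ∈ upTo N × y ≡ iter s i h) → key h ≤ key y
  case (i , _ , refl) = f (i , refl)

module _ {s : Fin N → Fin N} (inj : Injective _≡_ _≡_ s) where
  open Orbit inj

  vmin-reach : ∀ h → Reach s h (vmin toℕ s h)
  vmin-reach h with foldr-pick-∈ toℕ h (map (λ i → iter s i h) (upTo N))
  ... | here e = 0 , sym e
  ... | there m with ∈-map⁻ _ m
  ... | i , _ , e = i , sym e

  vmin-Min : ∀ h → Min s (vmin toℕ s h)
  vmin-Min h r with reach-trans (vmin-reach h) r
  ... | k , refl with reduce h k
  ... | i , i<P , e = subst (λ z → toℕ (vmin toℕ s h) ≤ toℕ z) e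
        (foldr-pick-≤ toℕ h _ (∈-map⁺ (λ i → iter s i h)
          (∈-upTo⁺ (<-≤-trans i<P (proj₁ (proj₂ (period h)))))))

  Min-unique : ∀ {x y} → Min s x → Min s y → Reach s x y → x ≡ y
  Min-unique mx my r = toℕ-injective (≤-antisym (mx r) (my (reach-sym r)))

  vmin-unique : ∀ {h m} → Min s m → Reach s h m → vmin toℕ s h ≡ m
  vmin-unique {h} mm r =
    Min-unique (vmin-Min h) mm (reach-trans (reach-sym (vmin-reach h)) r)

-- Both `preim` and `posF` are searches of this shape. Uniqueness of the hit frees their value from
-- the scanning order and from the default.
foldr-find : (P : E → Bool) (d : E) (xs : List E) {k : E} → k ∈ xs → T (P k) →
             (∀ {k′} → T (P k′) → k′ ≡ k) →
             foldr (λ k acc → if P k then k else acc) d xs ≡ k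
foldr-find P d (x ∷ xs) (here refl) pk u with P x
... | true = refl
foldr-find P d (x ∷ xs) (there m) pk u with P x in eq
... | true = u (subst T (sym eq) _)
... | false = foldr-find P d xs m pk u

preim-unique : {s : Fin N → Fin N} → Injective _≡_ _≡_ s → ∀ {c t} → s t ≡ c → preim s c ≡ t
preim-unique {N} {s} inj {c} {t} eq =
  foldr-find (λ h → s h == c) c (allFin N) (∈-allFin t) (≡⇒== eq)
    λ p → inj (trans (==⇒≡ _ _ p) (sym eq))

preim-correct : {s : Fin N → Fin N} → Injective _≡_ _≡_ s → ∀ c → s (preim s c) ≡ c
preim-correct {s = s} inj c with Orbit.preimage inj c
... | t , eq = trans (cong s (preim-unique inj eq)) eq

-- Counting

ind : Bool → ℕ
ind b = if b then 1 else 0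

sumL-tabulate : (f : Fin N → ℕ) → sumL (List.tabulate f) ≡ sum f
sumL-tabulate {zero} f = refl
sumL-tabulate {suc N} f = cong (f zero +_) (sumL-tabulate (f ∘ suc))

countB-sum : (P : Fin N → Bool) → countB P ≡ sum (ind ∘ P)
countB-sum P = trans (cong sumL (map-tabulate id (ind ∘ P))) (sumL-tabulate (ind ∘ P))

sum-zero : (f : Fin N → ℕ) → (∀ i → f i ≡ 0) → sum f ≡ 0
sum-zero {zero} f z = refl
sum-zero {suc N} f z = cong₂ _+_ (z zero) (sum-zero (f ∘ suc) (z ∘ suc))

sum-single : (f : Fin N → ℕ) (i : Fin N) → (∀ j → j ≢ i → f j ≡ 0) → sum f ≡ f i
sum-single {suc N} f zero z =
  trans (cong (f zero +_) (sum-zero (f ∘ suc) (λ j → z (suc j) λ ()))) (+-identityʳ _)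
sum-single {suc N} f (suc i) z =
  cong₂ _+_ (z zero λ ()) (sum-single (f ∘ suc) i (λ j ne → z (suc j) λ { refl → ne refl }))

sum-mono : (f g : Fin N → ℕ) → (∀ i → f i ≤ g i) → sum f ≤ sum g
sum-mono {zero} f g le = z≤n
sum-mono {suc N} f g le = +-mono-≤ (le zero) (sum-mono (f ∘ suc) (g ∘ suc) (le ∘ suc))

ind-false : {b : Bool} → ¬ T b → ind b ≡ 0
ind-false {true} f = ⊥-elim (f _)
ind-false {false} _ = refl

sum-ind-at : (b : Bool) (i : Fin N) → sum (λ j → ind (b ∧ (i == j))) ≡ ind b
sum-ind-at {N} false i = sum-zero {N} _ (λ _ → refl)
sum-ind-at true i =
  trans (sum-single _ i (λ j ne → ind-false (λ t → ne (sym (==⇒≡ i j t))))) (cong ind (==-refl i))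

-- Double counting of the pairs `(h , k)` with `k = f h`: each `h` in `P` has one such pair, and so
-- has each `k` in `Q`. The maps need to be inverse to each other only on the two sets.
count-bijection : (P Q : Fin N → Bool) (f g : Fin N → Fin N) →
  (∀ {h} → T (P h) → T (Q (f h)) × g (f h) ≡ h) →
  (∀ {h} → T (Q h) → T (P (g h)) × f (g h) ≡ h) →
  countB P ≡ countB Q
count-bijection P Q f g fwd bwd = begin
  countB P                                           ≡⟨ countB-sum P ⟩
  sum (λ h → ind (P h))                              ≡⟨ sum-cong-≗ (λ h → sum-ind-at (P h) (f h)) ⟨
  sum (λ h → sum (λ k → ind (P h ∧ (f h == k))))     ≡⟨ ∑-comm (λ h k → ind (P h ∧ (f h == k))) ⟩
  sum (λ k → sum (λ h → ind (P h ∧ (f h == k))))     ≡⟨ sum-cong-≗ (λ k → sum-cong-≗ (λ h → cong ind (T-ext (to h k) (from h k)))) ⟩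
  sum (λ k → sum (λ h → ind (Q k ∧ (g k == h))))     ≡⟨ sum-cong-≗ (λ k → sum-ind-at (Q k) (g k)) ⟩
  sum (λ k → ind (Q k))                              ≡⟨ countB-sum Q ⟨
  countB Q                                           ∎
  where
  open ≡-Reasoning
  to : ∀ h k → T (P h ∧ (f h == k)) → T (Q k ∧ (g k == h))
  to h k t with ∧-elim (P h) t
  ... | ph , e with ==⇒≡ (f h) k e
  ... | refl = ∧-intro {Q (f h)} (proj₁ (fwd ph)) (≡⇒== (proj₂ (fwd ph)))
  from : ∀ h k → T (Q k ∧ (g k == h)) → T (P h ∧ (f h == k))
  from h k t with ∧-elim (Q k) t
  ... | qk , e with ==⇒≡ (g k) h e
  ... | refl = ∧-intro {P (g k)} (proj₁ (bwd qk)) (≡⇒== (proj₂ (bwd qk)))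

count-split : (P Q R : Fin N → Bool) → (∀ h → ind (P h) ≡ ind (Q h) + ind (R h)) →
              countB P ≡ countB Q + countB R
count-split P Q R eq = begin
  countB P                              ≡⟨ countB-sum P ⟩
  sum (ind ∘ P)                         ≡⟨ sum-cong-≗ eq ⟩
  sum (λ h → ind (Q h) + ind (R h))     ≡⟨ ∑-distrib-+ (ind ∘ Q) (ind ∘ R) ⟩
  sum (ind ∘ Q) + sum (ind ∘ R)         ≡⟨ cong₂ _+_ (countB-sum Q) (countB-sum R) ⟨
  countB Q + countB R                   ∎
  where open ≡-Reasoning

count-at : (i : Fin N) → countB (i ==_) ≡ 1
count-at i = trans (countB-sum (i ==_)) (sum-ind-at true i)

count-remove : (P : Fin N → Bool) (i : Fin N) → T (P i) →
               countB P ≡ suc (countB (λ h → P h ∧ not (i == h)))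
count-remove P i pi =
  trans (count-split P (i ==_) (λ h → P h ∧ not (i == h)) split) 
        (cong (_+ countB (λ h → P h ∧ not (i == h))) (count-at i))
  where
  split : ∀ h → ind (P h) ≡ ind (i == h) + ind (P h ∧ not (i == h))
  split h with i ≟ h
  split h | no _ with P h
  ... | true = refl
  ... | false = refl
  split h | yes refl with P h
  ... | true = refl

count-≤-+ : (P Q R : Fin N → Bool) → (∀ {h} → T (P h) → T (Q h) ⊎ T (R h)) →
            countB P ≤ countB Q + countB R
count-≤-+ P Q R imp = begin
  countB P                              ≡⟨ countB-sum P ⟩
  sum (ind ∘ P)                         ≤⟨ sum-mono _ _ (λ h → le (P h) (Q h) (R h) imp) ⟩
  sum (λ h → ind (Q h) + ind (R h))     ≡⟨ ∑-distrib-+ (ind ∘ Q) (ind ∘ R) ⟩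
  sum (ind ∘ Q) + sum (ind ∘ R)         ≡⟨ cong₂ _+_ (countB-sum Q) (countB-sum R) ⟨
  countB Q + countB R                   ∎
  where
  open ≤-Reasoning
  le : ∀ p q r → (T p → T q ⊎ T r) → ind p ≤ ind q + ind r
  le false q r f = z≤n
  le true true r f = s≤s z≤n
  le true false true f = s≤s z≤n
  le true false false f with f _
  ... | inj₁ ()
  ... | inj₂ ()

count-all : countB {N} (λ _ → true) ≡ N
count-all {zero} = refl
count-all {suc N} = trans (countB-sum {suc N} (λ _ → true))
  (cong suc (trans (sym (countB-sum {N} (λ _ → true))) (count-all {N})))

-- The cyclic successor

toℕ-next-< : (i : Fin N) → suc (toℕ i) < N → toℕ (next i) ≡ suc (toℕ i)
toℕ-next-< {suc N} i lt = trans (toℕ-fromℕ< _) (m<n⇒m%n≡m lt)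

toℕ-next-last : (i : Fin N) → suc (toℕ i) ≡ N → toℕ (next i) ≡ 0
toℕ-next-last {suc N} i eq rewrite toℕ-fromℕ< (m%n<n (suc (toℕ i)) (suc N)) | eq = n%n≡0 (suc N)

next-case : (i : Fin N) → (suc (toℕ i) < N × toℕ (next i) ≡ suc (toℕ i)) ⊎
                          (suc (toℕ i) ≡ N × toℕ (next i) ≡ 0)
next-case {N} i with suc (toℕ i) <? N
... | yes lt = inj₁ (lt , toℕ-next-< i lt)
... | no ¬lt = inj₂ (eq , toℕ-next-last i eq)
  where eq = ≤-antisym (toℕ<n i) (≮⇒≥ ¬lt)

next-injective : Injective _≡_ _≡_ (next {N})
next-injective {N} {i} {j} eq with next-case i | next-case j
... | inj₁ (_ , p) | inj₁ (_ , q) = toℕ-injective (suc-injective (trans (sym p) (trans (cong toℕ eq) q)))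
... | inj₁ (_ , p) | inj₂ (_ , q) = contradiction (trans (sym p) (trans (cong toℕ eq) q)) λ ()
... | inj₂ (_ , p) | inj₁ (_ , q) = contradiction (trans (sym q) (trans (cong toℕ (sym eq)) p)) λ ()
... | inj₂ (p , _) | inj₂ (q , _) = toℕ-injective (suc-injective (trans p (sym q)))

swap-lengths : ∀ a d e → a + d + e ≡ a + e + d
swap-lengths a d e = trans (+-assoc a d e) (trans (cong (a +_) (+-comm d e)) (sym (+-assoc a e d)))

-- Exchanging the consecutive blocks (a , a+d+1] and (a+d+1 , a+d+1+e+1]

module _ (a d e : ℕ) where

  data Block (h : ℕ) : Set where
    low  : h ≤ a → Block h
    fst  : ∀ i → i ≤ d → h ≡ a + suc i → Block h
    snd  : ∀ j → j ≤ e → h ≡ a + suc d + suc j → Block h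
    high : a + suc d + suc e < h → Block h

  block : ∀ h → Block h
  block h with h ≤? a
  ... | yes p = low p
  ... | no ¬p with h ≤? a + suc d
  ... | yes q with m≤n⇒∃[o]m+o≡n (≰⇒> ¬p)
  ... | i , refl = fst i (≤-pred (+-cancelˡ-≤ a _ _ (≤-trans (≤-reflexive (+-suc a i)) q))) (sym (+-suc a i))
  block h | no ¬p | no ¬q with h ≤? a + suc d + suc e
  ... | no ¬r = high (≰⇒> ¬r)
  ... | yes r with m≤n⇒∃[o]m+o≡n (≰⇒> ¬q)
  ... | j , refl = snd j (≤-pred (+-cancelˡ-≤ (a + suc d) _ _ (≤-trans (≤-reflexive (+-suc (a + suc d) j)) r))) (sym (+-suc (a + suc d) j))

  exchange : ∀ {h} → Block h → ℕ
  exchange {h} (low _) = h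
  exchange (fst i _ _) = a + suc e + suc i
  exchange (snd j _ _) = a + suc j
  exchange {h} (high _) = h

  fst-bounds : ∀ i → i ≤ d → a < a + suc i × a + suc i ≤ a + suc d
  fst-bounds i le = m<m+n a (s≤s z≤n) , +-monoʳ-≤ a (s≤s le)

  snd-bounds : ∀ j → j ≤ e → a + suc d < a + suc d + suc j × a + suc d + suc j ≤ a + suc d + suc e
  snd-bounds j le = m<m+n (a + suc d) (s≤s z≤n) , +-monoʳ-≤ (a + suc d) (s≤s le)

  a<x : a < a + suc d
  a<x = m<m+n a (s≤s z≤n)

  x<c : a + suc d < a + suc d + suc e
  x<c = m<m+n (a + suc d) (s≤s z≤n)

  a<c : a < a + suc d + suc e
  a<c = <-trans a<x x<c

  -- Allows `sw` to be evaluated through any convenient classification of a position, not only the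
  -- one that `block` returns.
  exchange-unique : ∀ {h} (b b′ : Block h) → exchange b ≡ exchange b′
  exchange-unique (low _) (low _) = refl
  exchange-unique (low p) (fst i le refl) = contradiction (proj₁ (fst-bounds i le)) (≤⇒≯ p)
  exchange-unique (low p) (snd i le refl) = contradiction (<-trans a<x (proj₁ (snd-bounds i le))) (≤⇒≯ p)
  exchange-unique (low p) (high q) = contradiction (<-trans a<c q) (≤⇒≯ p)
  exchange-unique (fst i le refl) (low p) = contradiction (proj₁ (fst-bounds i le)) (≤⇒≯ p)
  exchange-unique (fst i _ refl) (fst j _ eq) = cong (a + suc e +_) (+-cancelˡ-≡ a _ _ eq)
  exchange-unique (fst i le refl) (snd j le′ eq) =
    contradiction (≤-<-trans (proj₂ (fst-bounds i le)) (proj₁ (snd-bounds j le′))) (<-irrefl eq)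
  exchange-unique (fst i le refl) (high q) =
    contradiction (≤-<-trans (proj₂ (fst-bounds i le)) (<-trans x<c q)) (<-irrefl refl)
  exchange-unique (snd i le refl) (low p) = contradiction (<-trans a<x (proj₁ (snd-bounds i le))) (≤⇒≯ p)
  exchange-unique (snd j le′ refl) (fst i le eq) =
    contradiction (≤-<-trans (proj₂ (fst-bounds i le)) (proj₁ (snd-bounds j le′))) (<-irrefl (sym eq))
  exchange-unique (snd i _ refl) (snd j _ eq) = cong (a +_) (+-cancelˡ-≡ (a + suc d) _ _ eq)
  exchange-unique (snd i le refl) (high q) = contradiction (proj₂ (snd-bounds i le)) (<⇒≱ q)
  exchange-unique (high q) (low p) = contradiction (<-trans a<c q) (≤⇒≯ p)
  exchange-unique (high q) (fst i le refl) =
    contradiction (≤-<-trans (proj₂ (fst-bounds i le)) (<-trans x<c q)) (<-irrefl refl)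
  exchange-unique (high q) (snd i le refl) = contradiction (proj₂ (snd-bounds i le)) (<⇒≱ q)
  exchange-unique (high _) (high _) = refl

  exchange-< : ∀ {h n} (b : Block h) → a + suc d + suc e < n → h < n → exchange b < n
  exchange-< (low _) _ lt = lt
  exchange-< {n = n} (fst i le _) lt _ =
    ≤-<-trans (+-monoʳ-≤ (a + suc e) (s≤s le)) (subst (_< n) (swap-lengths a (suc d) (suc e)) lt)
  exchange-< (snd j le _) lt _ = ≤-<-trans (≤-trans (+-monoʳ-≤ a (s≤s le)) (+-monoˡ-≤ (suc e) (m≤m+n a (suc d)))) lt
  exchange-< (high _) _ lt = lt

exchange-dual : ∀ a d e {h} (b : Block a d e h) → Block a e d (exchange a d e b)
exchange-dual a d e (low p) = low p
exchange-dual a d e (fst i le _) = snd i le refl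
exchange-dual a d e (snd j le _) = fst j le refl
exchange-dual a d e {h} (high q) = high (subst (_< h) (swap-lengths a (suc d) (suc e)) q)

exchange-dual-inverse : ∀ a d e {h} (b : Block a d e h) →
                        exchange a e d (exchange-dual a d e b) ≡ h
exchange-dual-inverse a d e (low p) = refl
exchange-dual-inverse a d e (fst i le eq) = sym eq
exchange-dual-inverse a d e (snd j le eq) = sym eq
exchange-dual-inverse a d e (high q) = refl

-- The half-edges a₁ < a₂ < a₃ of a gluing are A, X, C; in the canonical labelling of
-- the glued map their positions are A, C, C′ respectively.
record Blocks (N : ℕ) : Set where
  field
    a d e    : ℕ
    A X C C′ : Fin N
    toA  : toℕ A ≡ a
    toX  : toℕ X ≡ a + suc d
    toC  : toℕ C ≡ a + suc d + suc e
    toC′ : toℕ C′ ≡ a + suc e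

  c<N : a + suc d + suc e < N
  c<N = subst (_< N) toC (toℕ<n C)

  A<X : toℕ A < toℕ X
  A<X rewrite toA | toX = a<x a d e

  X<C : toℕ X < toℕ C
  X<C rewrite toX | toC = x<c a d e

  A<C : toℕ A < toℕ C
  A<C = <-trans A<X X<C

  sw : Fin N → Fin N
  sw h = fromℕ< (exchange-< a d e (block a d e (toℕ h)) c<N (toℕ<n h))

  toℕ-sw : ∀ h (b : Block a d e (toℕ h)) → toℕ (sw h) ≡ exchange a d e b
  toℕ-sw h b = trans (toℕ-fromℕ< _) (exchange-unique a d e (block a d e (toℕ h)) b)

  sw-low : ∀ {h} → toℕ h ≤ toℕ A → sw h ≡ h
  sw-low {h} le = toℕ-injective (toℕ-sw h (low (subst (toℕ h ≤_) toA le)))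

  sw-high : ∀ {h} → toℕ C < toℕ h → sw h ≡ h
  sw-high {h} lt = toℕ-injective (toℕ-sw h (high (subst (_< toℕ h) toC lt)))

  sw-A : sw A ≡ A
  sw-A = sw-low ≤-refl

  sw-X : sw X ≡ C
  sw-X = toℕ-injective (trans (toℕ-sw X (fst d ≤-refl toX)) (trans (swap-lengths a (suc e) (suc d)) (sym toC)))

  sw-C : sw C ≡ C′
  sw-C = toℕ-injective (trans (toℕ-sw C (snd e ≤-refl toC)) (sym toC′))

-- The blocks as they stand after the exchange: the lengths are interchanged, the cut between the
-- blocks is at `C′`, and `X` is where `C` returns to.
dual : Blocks N → Blocks N
dual B = record
  { a = a ; d = e ; e = d ; A = A ; X = C′ ; C = C ; C′ = X
  ; toA = toA ; toX = toC′ ; toC = trans toC (swap-lengths a (suc d) (suc e)) ; toC′ = toX }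
  where open Blocks B

module _ (B : Blocks N) where
  open Blocks B
  private module D = Blocks (dual B)

  sw-dual : ∀ h → D.sw (sw h) ≡ h
  sw-dual h = toℕ-injective (begin
    toℕ (D.sw (sw h))                              ≡⟨ D.toℕ-sw (sw h) b′ ⟩
    exchange a e d b′                              ≡⟨ lemma b′ (exchange-dual a d e b) (toℕ-sw h b) ⟩
    exchange a e d (exchange-dual a d e b)         ≡⟨ exchange-dual-inverse a d e b ⟩
    toℕ h                                          ∎)
    where
    open ≡-Reasoning
    b = block a d e (toℕ h)
    b′ = block a e d (toℕ (sw h))
    lemma : ∀ {k l} (b₁ : Block a e d k) (b₂ : Block a e d l) → k ≡ l → exchange a e d b₁ ≡ exchange a e d b₂
    lemma b₁ b₂ refl = exchange-unique a e d b₁ b₂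

  -- The exchange fixes all positions up to `A` and permutes those above. Hence vertex minima at or
  -- below `A` can survive it.
  sw-≥ : ∀ {w h} → w ≤ toℕ A → w ≤ toℕ h → w ≤ toℕ (sw h)
  sw-≥ {w} {h} wa wh rewrite toℕ-sw h (block a d e (toℕ h)) with block a d e (toℕ h)
  ... | low _ = wh
  ... | fst i _ _ = ≤-trans (subst (w ≤_) toA wa) (≤-trans (m≤m+n a (suc e)) (m≤m+n _ (suc i)))
  ... | snd j _ _ = ≤-trans (subst (w ≤_) toA wa) (m≤m+n a (suc j))
  ... | high _ = wh

  sw-fst : ∀ {h} → toℕ A < toℕ h → toℕ h ≤ toℕ X → toℕ C′ < toℕ (sw h)
  sw-fst {h} lo hi rewrite toℕ-sw h (block a d e (toℕ h)) | toA | toX | toC′ with block a d e (toℕ h)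
  ... | low p = contradiction lo (≤⇒≯ p)
  ... | fst i _ _ = m<m+n (a + suc e) (s≤s z≤n)
  ... | snd j le eq = contradiction (proj₁ (snd-bounds a d e j le)) (≤⇒≯ (subst (_≤ _) eq hi))
  ... | high q = contradiction (<-trans (x<c a d e) q) (≤⇒≯ hi)

  sw-snd : ∀ {h} → toℕ X < toℕ h → toℕ h ≤ toℕ C → toℕ (sw h) ≤ toℕ C′
  sw-snd {h} lo hi rewrite toℕ-sw h (block a d e (toℕ h)) | toX | toC | toC′ with block a d e (toℕ h)
  ... | low p = contradiction (<-trans (a<x a d e) lo) (≤⇒≯ p)
  ... | fst i le eq = contradiction (proj₂ (fst-bounds a d e i le)) (<⇒≱ (subst (_ <_) eq lo))
  ... | snd j le _ = +-monoʳ-≤ a (s≤s le)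
  ... | high q = contradiction q (≤⇒≯ hi)

  A≢X : A ≢ X
  A≢X eq = <-irrefl (cong toℕ eq) A<X

  A≢C : A ≢ C
  A≢C eq = <-irrefl (cong toℕ eq) A<C

  X≢C : X ≢ C
  X≢C eq = <-irrefl (cong toℕ eq) X<C

  private
    equate : ∀ {i k m l} → toℕ i ≡ m → (b : Block a d e (toℕ k)) → exchange a d e b ≡ l → m ≡ l → i ≡ sw k
    equate {k = k} p b q r = toℕ-injective (trans p (trans r (trans (sym q) (sym (toℕ-sw k b)))))

    toC-dual : toℕ C ≡ a + suc e + suc d
    toC-dual = trans toC (swap-lengths a (suc d) (suc e))

  -- The exchange commutes with the successor except at `A`, `X` and `C`, which take over the
  -- successors of `X`, `C` and `A` respectively.
  next-sw-A : next (sw A) ≡ sw (next X)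
  next-sw-A rewrite sw-A = equate {m = suc a}
    (trans (toℕ-next-< A (≤-<-trans A<C (toℕ<n C))) (cong suc toA))
    (snd 0 z≤n (trans (toℕ-next-< X (≤-<-trans X<C (toℕ<n C))) (trans (cong suc toX) (trans (cong suc (sym (+-identityʳ _))) (sym (+-suc _ 0))))))
    refl (trans (cong suc (sym (+-identityʳ a))) (sym (+-suc a 0)))

  next-sw-C : next (sw C) ≡ sw (next A)
  next-sw-C rewrite sw-C = equate {m = suc (a + suc e)}
    (trans (toℕ-next-< C′ (≤-<-trans (Blocks.X<C (dual B)) (toℕ<n C))) (cong suc toC′))
    (fst 0 z≤n (trans (toℕ-next-< A (≤-<-trans A<C (toℕ<n C))) (trans (cong suc toA) (trans (cong suc (sym (+-identityʳ a))) (sym (+-suc a 0))))))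
    refl (trans (cong suc (sym (+-identityʳ _))) (sym (+-suc _ 0)))

  next-sw-X : next (sw X) ≡ sw (next C)
  next-sw-X rewrite sw-X with next-case C
  ... | inj₁ (_ , p) = sym (sw-high (subst (toℕ C <_) (sym p) ≤-refl))
  -- If `C` is the last half-edge, its successor wraps to `0`, which is not above `A` and hence
  -- fixed too.
  ... | inj₂ (_ , p) = sym (sw-low (subst (_≤ toℕ A) (sym p) z≤n))

  next-sw : ∀ {h} → h ≢ A → h ≢ X → h ≢ C → next (sw h) ≡ sw (next h)
  next-sw {h} nA nX nC = go (block a d e (toℕ h))
   where
   go : Block a d e (toℕ h) → next (sw h) ≡ sw (next h)
   go (low p) = trans (cong next (sw-low h≤A))
          (sym (sw-low (subst (_≤ toℕ A) (sym (toℕ-next-< h (≤-<-trans h<A (toℕ<n A)))) h<A)))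
    where
    h≤A = subst (toℕ h ≤_) (sym toA) p
    h<A = ≤∧≢⇒< h≤A (nA ∘ toℕ-injective)
   go (fst i i≤d eq) = equate
          (trans (toℕ-next-< (sw h) (≤-trans (s≤s lt) (toℕ<n C))) (cong suc (toℕ-sw h (fst i i≤d eq))))
          (fst (suc i) i<d (trans (toℕ-next-< h (≤-trans (s≤s lt′) (toℕ<n C))) (trans (cong suc eq) (sym (+-suc a (suc i))))))
          refl (sym (+-suc _ _))
    where
    i<d : i < d
    i<d = ≤∧≢⇒< i≤d λ { refl → nX (toℕ-injective (trans eq (sym toX))) }
    lt : toℕ (sw h) < toℕ C
    lt = subst₂ _<_ (sym (toℕ-sw h (fst i i≤d eq))) (sym toC-dual) (+-monoʳ-< (a + suc e) (s≤s i<d))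
    lt′ : toℕ h < toℕ C
    lt′ = <-trans (subst₂ _<_ (sym eq) (sym toX) (+-monoʳ-< a (s≤s i<d))) X<C
   go (snd j j≤e eq) = equate
          (trans (toℕ-next-< (sw h) (≤-trans (s≤s lt) (toℕ<n C))) (cong suc (toℕ-sw h (snd j j≤e eq))))
          (snd (suc j) j<e (trans (toℕ-next-< h (≤-trans (s≤s lt′) (toℕ<n C))) (trans (cong suc eq) (sym (+-suc _ (suc j))))))
          refl (sym (+-suc _ _))
    where
    j<e : j < e
    j<e = ≤∧≢⇒< j≤e λ { refl → nC (toℕ-injective (trans eq (sym toC))) }
    lt : toℕ (sw h) < toℕ C
    lt = <-trans (subst₂ _<_ (sym (toℕ-sw h (snd j j≤e eq))) (sym toC′) (+-monoʳ-< a (s≤s j<e))) (Blocks.X<C (dual B))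
    lt′ : toℕ h < toℕ C
    lt′ = subst₂ _<_ (sym eq) (sym toC) (+-monoʳ-< (a + suc d) (s≤s j<e))
   go (high q) with next-case h
   ... | inj₁ (_ , p) = trans (cong next (sw-high C<h)) (sym (sw-high (subst (toℕ C <_) (sym p) (m≤n⇒m≤1+n C<h))))
    where C<h = subst (_< toℕ h) (sym toC) q
   ... | inj₂ (_ , p) = trans (cong next (sw-high C<h)) (sym (sw-low (subst (_≤ toℕ A) (sym p) z≤n)))
    where C<h = subst (_< toℕ h) (sym toC) q

-- Walking around a vertex: descents and arcs

Below : (Fin N → Fin N) → Fin N → Fin N → Set
Below s w c = ∀ {y} → Reach s c y → toℕ w < toℕ y

-- The trisection condition at `c = σ(τ)` without the demand that `c` is not a minimum. Equality is
-- allowed, so a vertex consisting of `c` alone qualifies.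
Desc : (Fin N → Fin N) → Fin N → Set
Desc s c = ∃ λ τ → s τ ≡ c × toℕ c ≤ toℕ τ

-- Only the points before the end must differ from `c`, so these paths explore the arc from `x` up
-- to and including the first visit to `c`.
data Path (s : E → E) (c : E) : E → E → Set where
  here : ∀ {x} → Path s c x x
  step : ∀ {x y} → x ≢ c → Path s c (s x) y → Path s c x y

module _ {s : E → E} {c : E} where

  path-trans : ∀ {x y z} → Path s c x y → Path s c y z → Path s c x z
  path-trans here q = q
  path-trans (step ne p) q = step ne (path-trans p q)

  path-snoc : ∀ {x y} → Path s c x y → y ≢ c → Path s c x (s y)
  path-snoc p ne = path-trans p (step ne here)

  path-reach : ∀ {x y} → Path s c x y → Reach s x y
  path-reach here = reach-refl
  path-reach (step _ p) = reach-trans (1 , refl) (path-reach p)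

  path-invariant : (P : E → Set) → (∀ {x} → x ≢ c → P x → P (s x)) →
                   ∀ {x y} → Path s c x y → P x → P y
  path-invariant P f here px = px
  path-invariant P f (step ne p) px = path-invariant P f p (f ne px)

  -- A closed path avoiding c is a whole orbit, which therefore does not contain c.
  path-no-return : ∀ {z} → z ≢ c → Path s c (s z) z → ¬ Reach s z c
  path-no-return {z} z≢c loop r = avoids (reach-invariant (λ h → Path s c h z) follow r here)
    where
    avoids : ¬ Path s c c z
    avoids here = z≢c refl
    avoids (step ne _) = ne refl
    follow : ∀ {x} → Path s c x z → Path s c (s x) z
    follow here = loop
    follow (step _ p) = p

module _ {s : Fin N → Fin N} {c : Fin N} where

  path-to : ∀ k {x} → iter s k x ≡ c → Path s c x c
  path-to zero refl = here
  path-to (suc k) {x} eq with x ≟ c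
  ... | yes refl = here
  ... | no ne = step ne (path-to k (trans (iter-shift s k x) eq))

  path-pred : Injective _≡_ _≡_ s → ∀ {x τ} → s τ ≡ c → x ≢ c → Path s c x c → Path s c x τ
  path-pred inj eq ne here = contradiction refl ne
  path-pred inj {x} eq ne (step _ p) with s x ≟ c
  ... | yes e = subst (Path s c x) (inj (trans e (sym eq))) here
  ... | no ne′ = step ne (path-pred inj eq ne′ p)

  Smallest : Fin N → Fin N → Set
  Smallest x m = Path s c x m × toℕ c < toℕ m × (∀ {h} → Path s c x h → toℕ c < toℕ h → toℕ m ≤ toℕ h)

  smallest-on-path : ∀ {x} → Path s c x c →
    (∀ {h} → Path s c x h → ¬ toℕ c < toℕ h) ⊎ ∃ (Smallest x)
  smallest-on-path {x} p with x ≟ c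
  ... | yes refl = inj₁ λ { here lt → <-irrefl refl lt ; (step ne _) → contradiction refl ne }
  smallest-on-path here | no ne = contradiction refl ne
  smallest-on-path {x} (step _ p) | no ne with smallest-on-path p | toℕ c <? toℕ x
  ... | inj₁ none | no ¬lt = inj₁ λ { here lt → ¬lt lt ; (step _ q) lt → none q lt }
  ... | inj₁ none | yes lt = inj₂ (x , here , lt ,
          λ { here _ → ≤-refl ; (step _ q) lt′ → contradiction lt′ (none q) })
  ... | inj₂ (m , pm , lm , mm) | no ¬lt = inj₂ (m , step ne pm , lm ,
          λ { here lt → contradiction lt ¬lt ; (step _ q) lt → mm q lt })
  ... | inj₂ (m , pm , lm , mm) | yes lt with ≤-total (toℕ m) (toℕ x)
  ... | inj₁ le = inj₂ (m , step ne pm , lm , λ { here _ → le ; (step _ q) lt → mm q lt })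
  ... | inj₂ le = inj₂ (x , here , lt , λ { here _ → ≤-refl ; (step _ q) lt → ≤-trans le (mm q lt) })

-- Gluing and slicing as conjugation by a block exchange

Conj : Blocks N → (Fin N → Fin N) → (Fin N → Fin N) → Set
Conj B α β = ∀ h → β (Blocks.sw B h) ≡ Blocks.sw B (α h)

conj-dual : (B : Blocks N) {α β : Fin N → Fin N} → Conj B α β → Conj (dual B) β α
conj-dual B {α} {β} conj h = begin
  α (D.sw h)                  ≡⟨ sw-dual B _ ⟨
  D.sw (sw (α (D.sw h)))      ≡⟨ cong D.sw (conj (D.sw h)) ⟨
  D.sw (β (sw (D.sw h)))      ≡⟨ cong (D.sw ∘ β) (sw-dual (dual B) h) ⟩
  D.sw (β h)                  ∎
  where
  open ≡-Reasoning
  open Blocks B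
  module D = Blocks (dual B)

-- Here `s` is the permutation before and `t` the one after the exchange, whether this merges
-- vertices (`Forward`) or splits one (`Slice`).
module Glue (B : Blocks N) {α β : Fin N → Fin N} (conj : Conj B α β) (injα : Injective _≡_ _≡_ α) where
  open Blocks B public
  private module D = Blocks (dual B)

  s t : Fin N → Fin N
  s h = α (next h)
  t h = β (next h)

  sw-injective : Injective _≡_ _≡_ sw
  sw-injective {x} {y} eq = trans (sym (sw-dual B x)) (trans (cong D.sw eq) (sw-dual B y))

  s-injective : Injective _≡_ _≡_ s
  s-injective = next-injective ∘ injα

  β-injective : Injective _≡_ _≡_ β
  β-injective {x} {y} eq = begin
    x               ≡⟨ sw-dual (dual B) x ⟨
    sw (D.sw x)     ≡⟨ cong sw (injα {D.sw x} {D.sw y} same) ⟩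
    sw (D.sw y)     ≡⟨ sw-dual (dual B) y ⟩
    y               ∎
    where
    open ≡-Reasoning
    same : α (D.sw x) ≡ α (D.sw y)
    same = trans (conj-dual B {α} {β} conj x) (trans (cong D.sw eq) (sym (conj-dual B {α} {β} conj y)))

  t-injective : Injective _≡_ _≡_ t
  t-injective = next-injective ∘ β-injective

  open Orbit s-injective

  -- Read through `sw`, which takes `A`, `X`, `C` to `A`, `C`, `C′`, these are the three values that
  -- `glue` changes.
  t-A : t A ≡ sw (s X)
  t-A = trans (cong t (sym sw-A)) (trans (cong β (next-sw-A B)) (conj _))

  t-C : t C ≡ sw (s C)
  t-C = trans (cong t (sym sw-X)) (trans (cong β (next-sw-X B)) (conj _))

  t-C′ : t C′ ≡ sw (s A)
  t-C′ = trans (cong t (sym sw-C)) (trans (cong β (next-sw-C B)) (conj _))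

  t-other : ∀ {h} → h ≢ A → h ≢ X → h ≢ C → t (sw h) ≡ sw (s h)
  t-other nA nX nC = trans (cong β (next-sw B nA nX nC)) (conj _)

  C′<C : toℕ C′ < toℕ C
  C′<C = D.X<C

  A<C′ : toℕ A < toℕ C′
  A<C′ = D.A<X

  Off : Fin N → Set
  Off h = ∀ {y} → Reach s h y → y ≢ A × y ≢ X × y ≢ C

  off-transfer : ∀ {h} → Off h → ∀ k → iter t k (sw h) ≡ sw (iter s k h)
  off-transfer off zero = refl
  off-transfer off (suc k) with off (k , refl)
  ... | nA , nX , nC = trans (cong t (off-transfer off k)) (t-other nA nX nC)

  Min-transfer : ∀ {w} → Off w → toℕ w ≤ toℕ A → Min s w → Min t w
  Min-transfer {w} off le mw (k , refl) =
    subst (λ z → toℕ w ≤ toℕ z)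
      (trans (sym (off-transfer off k)) (cong (iter t k) (sw-low le)))
      (sw-≥ B le (mw (k , refl)))

  module Forward (mA : Min s A) (mX : Min s X) (bel : Below s X C) (desc : Desc s C) where

    A↛X : ¬ Reach s A X
    A↛X r = <⇒≱ A<X (mX (reach-sym r))

    C↛A : ¬ Reach s C A
    C↛A r = <-asym A<X (bel r)

    C↛X : ¬ Reach s C X
    C↛X r = <-irrefl refl (bel r)

    off-below : ∀ {w} → Min s w → toℕ w < toℕ A → Off w
    off-below mw lt r =
      (λ { refl → <⇒≱ lt (mA (reach-sym r)) }) ,
      (λ { refl → <⇒≱ (<-trans lt A<X) (mX (reach-sym r)) }) ,
      (λ { refl → <-asym (<-trans lt A<X) (bel (reach-sym r)) })

    Min-below : ∀ {w} → Min s w → toℕ w < toℕ A → Min t w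
    Min-below mw lt = Min-transfer (off-below mw lt) (<⇒≤ lt) mw

    Merged : Fin N → Set
    Merged h = Reach s A h ⊎ Reach s X h ⊎ Reach s C h

    merged-suc : ∀ {h} → Merged h → Merged (s h)
    merged-suc (inj₁ r) = inj₁ (reach-suc r)
    merged-suc (inj₂ (inj₁ r)) = inj₂ (inj₁ (reach-suc r))
    merged-suc (inj₂ (inj₂ r)) = inj₂ (inj₂ (reach-suc r))

    merged-≥ : ∀ {h} → Merged h → toℕ A ≤ toℕ h
    merged-≥ (inj₁ r) = mA r
    merged-≥ (inj₂ (inj₁ r)) = ≤-trans (<⇒≤ A<X) (mX r)
    merged-≥ (inj₂ (inj₂ r)) = <⇒≤ (<-trans A<X (bel r))

    private
      Image : Fin N → Set
      Image g = ∃ λ h → g ≡ sw h × Merged h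

      image-suc : ∀ {g} → Image g → Image (t g)
      image-suc (h , refl , m) with h ≟ A | h ≟ X | h ≟ C
      ... | yes refl | _ | _ = s X , trans (cong t sw-A) t-A , inj₂ (inj₁ (1 , refl))
      ... | no _ | yes refl | _ = s C , trans (cong t sw-X) t-C , inj₂ (inj₂ (1 , refl))
      ... | no _ | no _ | yes refl = s A , trans (cong t sw-C) t-C′ , inj₁ (1 , refl)
      ... | no nA | no nX | no nC = s h , t-other nA nX nC , merged-suc m

      image-≥ : ∀ {g} → Image g → toℕ A ≤ toℕ g
      image-≥ (h , refl , m) = sw-≥ B ≤-refl (merged-≥ m)

    glued-≥ : ∀ {y} → Reach t C′ y → toℕ A ≤ toℕ y
    glued-≥ r = image-≥ (reach-invariant Image image-suc r (C , sym sw-C , inj₂ (inj₂ reach-refl)))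

    glued-Min-A : Min t A
    glued-Min-A r = image-≥ (reach-invariant Image image-suc r (A , sym sw-A , inj₁ reach-refl))

    private
      -- As long as `Z` is not met, `t` copies the walk of `s` towards `Z`. The copy must stop
      -- there, because for `Z = A` and `Z = X` the value at `Z` is rewired.
      follow : ∀ {Z} → (∀ {y} → Reach s y Z → y ≢ Z → t (sw y) ≡ sw (s y) × y ≢ C) →
               ∀ k {h} → iter s k h ≡ Z → Path t C′ (sw h) (sw Z)
      follow f zero refl = here
      follow {Z} f (suc k) {h} eq with h ≟ Z
      ... | yes refl = here
      ... | no ne with f (suc k , eq) ne
      ... | e , nC = step (λ e′ → nC (sw-injective (trans e′ (sym sw-C))))
                       (subst (λ z → Path t C′ z (sw Z)) (sym e)
                         (follow f k (trans (iter-shift s k h) eq)))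

    C′→A : Reach t C′ A
    C′→A = reach-trans (1 , t-C′) (subst (Reach t (sw (s A))) sw-A
      (path-reach (follow good (proj₁ back) (proj₂ back))))
      where
      back = reach-sym {A} {s A} (1 , refl)
      good : ∀ {y} → Reach s y A → y ≢ A → t (sw y) ≡ sw (s y) × y ≢ C
      good r ne = t-other ne (λ { refl → A↛X (reach-sym r) }) nC , nC
        where nC = λ { refl → C↛A r }

    path-A-C : Path t C′ A C
    path-A-C = step (λ e → <-irrefl (cong toℕ e) A<C′)
      (subst₂ (Path t C′) (sym t-A) sw-X (follow good (proj₁ back) (proj₂ back)))
      where
      back = reach-sym {X} {s X} (1 , refl)
      good : ∀ {y} → Reach s y X → y ≢ X → t (sw y) ≡ sw (s y) × y ≢ C
      good r ne = t-other (λ { refl → A↛X r }) ne nC , nC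
        where nC = λ { refl → C↛X r }

    -- After `A`, the arc up to `C′` carries the vertices of `X` and of `C`, where all half-edges
    -- are at least `X`. The exchange takes those in `(X , C]` to at most `C′`, takes `X` to `C`,
    -- and fixes those beyond `C`.
    C-smallest : ∀ {h} → Path t C′ A h → toℕ C′ < toℕ h → toℕ C ≤ toℕ h
    C-smallest p lt = bound (path-invariant P P-suc p (A , sym sw-A , inj₁ refl)) lt
      where
      P : Fin N → Set
      P g = ∃ λ h → g ≡ sw h × (h ≡ A ⊎ Reach s X h ⊎ Reach s C h)
      P-suc : ∀ {g} → g ≢ C′ → P g → P (t g)
      P-suc ne (h , refl , inj₁ refl) = s X , trans (cong t sw-A) t-A , inj₂ (inj₁ (1 , refl))
      P-suc ne (h , refl , inj₂ (inj₁ r)) with h ≟ X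
      ... | yes refl = s C , trans (cong t sw-X) t-C , inj₂ (inj₂ (1 , refl))
      ... | no nX = s h , t-other (λ { refl → A↛X (reach-sym r) }) nX (λ { refl → C↛X (reach-sym r) })
                  , inj₂ (inj₁ (reach-suc r))
      P-suc ne (h , refl , inj₂ (inj₂ r)) =
        s h , t-other (λ { refl → C↛A r }) (λ { refl → C↛X r }) (λ { refl → ne sw-C })
            , inj₂ (inj₂ (reach-suc r))
      upper : ∀ h → toℕ X ≤ toℕ h → toℕ C′ < toℕ (sw h) → toℕ C ≤ toℕ (sw h)
      upper h le lt with h ≟ X | toℕ h ≤? toℕ C
      ... | yes refl | _ = ≤-reflexive (cong toℕ (sym sw-X))
      ... | no nX | yes h≤C =
        contradiction lt (≤⇒≯ (sw-snd B (≤∧≢⇒< le (nX ∘ sym ∘ toℕ-injective)) h≤C))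
      ... | no nX | no h≰C = subst (λ z → toℕ C ≤ toℕ z) (sym (sw-high (≰⇒> h≰C))) (<⇒≤ (≰⇒> h≰C))
      bound : ∀ {g} → P g → toℕ C′ < toℕ g → toℕ C ≤ toℕ g
      bound (h , refl , inj₁ refl) lt = contradiction (subst (λ z → toℕ C′ < toℕ z) sw-A lt) (<-asym A<C′)
      bound (h , refl , inj₂ (inj₁ r)) lt = upper h (mX r) lt
      bound (h , refl , inj₂ (inj₂ r)) lt = upper h (<⇒≤ (bel r)) lt

    -- Either the vertex of `C` is `C` alone, and then `C′` is entered from position `C`, the new
    -- place of `X`; or the predecessor of `C` exceeds `C`, so it is fixed and remains the
    -- predecessor.
    glued-Desc : Desc t C′
    glued-Desc = go desc
     where
     go : Desc s C → Desc t C′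
     go (τ , eq , le) with τ ≟ C
     ... | yes refl = C , trans t-C (trans (cong sw eq) sw-C) , <⇒≤ C′<C
     ... | no nC = τ , trans (cong t (sym (sw-high C<τ))) (trans (t-other
               (λ { refl → <⇒≱ A<C le }) (λ { refl → <⇒≱ X<C le }) nC) (trans (cong sw eq) sw-C))
               , <⇒≤ (<-trans C′<C C<τ)
       where C<τ = ≤∧≢⇒< le (nC ∘ sym ∘ toℕ-injective)

  -- Here A is the minimum of the vertex of X, and C is the smallest half-edge exceeding X on
  -- the way from A to X; exchanging the blocks splits this vertex into those of A, C′ and C.
  module Slice (mA : Min s A) (A→X : Reach s A X) (smallest : Smallest {s = s} {X} A C)
               (desc : Desc s X) where

    private
      path-AC = proj₁ smallest
      C-least = proj₂ (proj₂ smallest)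

      A→C : Reach s A C
      A→C = path-reach path-AC

      C→X : Reach s C X
      C→X = reach-trans (reach-sym A→C) A→X

      path-sA-C : Path s X (s A) C
      path-sA-C = tail path-AC refl
        where
        tail : ∀ {x} → Path s X x C → x ≡ A → Path s X (s x) C
        tail here e = contradiction (sym e) (A≢C B)
        tail (step _ p) _ = p

      A≢X′ = A≢X B
      C≢X : C ≢ X
      C≢X = X≢C B ∘ sym

      no-return-A : ¬ Path s X (s A) A
      no-return-A p = path-no-return A≢X′ p A→X

      no-return-C : ¬ Path s X (s C) C
      no-return-C p = path-no-return C≢X p C→X

      -- Up to `X`, such a half-edge lies in the first block, which moves past `C′`. Beyond `X`, the
      -- choice of `C` puts it above `C`, where nothing moves.
      above : ∀ {h} → Path s X A h → h ≢ A → h ≢ C → toℕ C′ < toℕ (sw h)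
      above {h} p nA nC with toℕ h ≤? toℕ X
      ... | yes le = sw-fst B (≤∧≢⇒< (mA (path-reach p)) (nA ∘ sym ∘ toℕ-injective)) le
      ... | no gt = subst (λ z → toℕ C′ < toℕ z) (sym (sw-high C<h)) (<-trans C′<C C<h)
        where C<h = ≤∧≢⇒< (C-least p (≰⇒> gt)) (nC ∘ sym ∘ toℕ-injective)

    off-below : ∀ {w} → Below s w X → Off w
    off-below bw r =
      (λ { refl → absurd (reach-trans r A→X) }) ,
      (λ { refl → absurd r }) ,
      (λ { refl → absurd (reach-trans r C→X) })
      where
      absurd : ¬ Reach s _ X
      absurd r = <-irrefl refl (bw (reach-sym r))

    below-A : ∀ {w} → Below s w X → toℕ w < toℕ A
    below-A bw = bw (reach-sym A→X)

    Min-below : ∀ {w} → Min s w → Below s w X → Min t w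
    Min-below mw bw = Min-transfer (off-below bw) (<⇒≤ (below-A bw)) mw

    sliced-Min-A : Min t A
    sliced-Min-A r = bound (reach-invariant P P-suc r (A , sym sw-A , reach-refl))
      where
      P : Fin N → Set
      P g = ∃ λ h → g ≡ sw h × Reach s A h
      P-suc : ∀ {g} → P g → P (t g)
      P-suc (h , refl , r) with h ≟ A | h ≟ X | h ≟ C
      ... | yes refl | _ | _ = s X , trans (cong t sw-A) t-A , reach-suc A→X
      ... | no _ | yes refl | _ = s C , trans (cong t sw-X) t-C , reach-suc A→C
      ... | no _ | no _ | yes refl = s A , trans (cong t sw-C) t-C′ , reach-suc reach-refl
      ... | no nA | no nX | no nC = s h , t-other nA nX nC , reach-suc r
      bound : ∀ {g} → P g → toℕ A ≤ toℕ g
      bound (h , refl , r) = sw-≥ B ≤-refl (mA r)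

    sliced-Min-C′ : Min t C′
    sliced-Min-C′ r = bound (reach-invariant P P-suc r (C , sym sw-C , path-sA-C , here))
      where
      P : Fin N → Set
      -- The first path places `h` on the arc governed by `above`; the second says that `C` is still
      -- ahead, so the orbit closes up at `C`.
      P g = ∃ λ h → g ≡ sw h × Path s X (s A) h × Path s X h C
      P-suc : ∀ {g} → P g → P (t g)
      P-suc (h , refl , p , here) = s A , trans (cong t sw-C) t-C′ , here , path-sA-C
      P-suc (h , refl , p , step nX q) with h ≟ C
      ... | yes refl = s A , trans (cong t sw-C) t-C′ , here , path-sA-C
      ... | no nC = s h , t-other (λ { refl → no-return-A p }) nX nC , path-snoc p nX , q
      bound : ∀ {g} → P g → toℕ C′ ≤ toℕ g
      bound (h , refl , p , _) with h ≟ C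
      ... | yes refl = ≤-reflexive (cong toℕ (sym sw-C))
      ... | no nC = <⇒≤ (above (step A≢X′ p) (λ { refl → no-return-A p }) nC)

    sliced-Below : Below t C′ C
    sliced-Below r = bound (reach-invariant P P-suc r (X , sym sw-X , start))
      where
      P : Fin N → Set
      P g = ∃ λ h → g ≡ sw h × Path s X (s C) h
      start : Path s X (s C) X
      start with path-to (proj₁ C→X) (proj₂ C→X)
      ... | q = tail q refl
        where
        tail : ∀ {x} → Path s X x X → x ≡ C → Path s X (s C) X
        tail here e = contradiction (sym e) C≢X
        tail (step _ p) refl = p
      nA : ∀ {h} → Path s X (s C) h → h ≢ A
      nA p refl = no-return-A (path-trans path-sA-C (step C≢X p))
      nC : ∀ {h} → Path s X (s C) h → h ≢ C
      nC p refl = no-return-C p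
      P-suc : ∀ {g} → P g → P (t g)
      P-suc (h , refl , p) with h ≟ X
      ... | yes refl = s C , trans (cong t sw-X) t-C , here
      ... | no nX = s h , t-other (nA p) nX (nC p) , path-snoc p nX
      bound : ∀ {g} → P g → toℕ C′ < toℕ g
      bound (h , refl , p) = above (path-trans path-AC (step C≢X p)) (nA p) (nC p)

    -- The predecessor of `X` exceeds `X` and lies on the arc from `A`, so it is at least `C`. If it
    -- is `C`, the new vertex is `C` alone; otherwise it is fixed by the exchange and remains the
    -- predecessor.
    sliced-Desc : Desc t C
    sliced-Desc = go desc
     where
     go : Desc s X → Desc t C
     go (τ , eq , le) with τ ≟ C
     ... | yes refl = C , trans t-C (trans (cong sw eq) sw-X) , ≤-refl
     ... | no nC = τ , trans (cong t (sym (sw-high C<τ))) (trans (t-other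
                   (λ { refl → <⇒≱ A<X le }) nX nC) (trans (cong sw eq) sw-X)) , <⇒≤ C<τ
       where
       nX : τ ≢ X
       nX refl = contradiction (reach-invariant (_≡ X) (λ { refl → eq }) (reach-sym A→X) refl) A≢X′
       X<τ : toℕ X < toℕ τ
       X<τ = ≤∧≢⇒< le (nX ∘ sym ∘ toℕ-injective)
       C<τ : toℕ C < toℕ τ
       C<τ = ≤∧≢⇒<
         (C-least (path-pred s-injective eq A≢X′ (path-to (proj₁ A→X) (proj₂ A→X))) X<τ)
         (nC ∘ sym ∘ toℕ-injective)

-- The effect of gluing on the number of vertices

isMin : (Fin N → Fin N) → Fin N → Bool
isMin s h = vmin toℕ s h == h

isMin⇒Min : {s : Fin N → Fin N} → Injective _≡_ _≡_ s → ∀ h → T (isMin s h) → Min s h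
isMin⇒Min {s = s} inj h p = subst (Min s) (==⇒≡ (vmin toℕ s h) h p) (vmin-Min inj h)

Min⇒isMin : {s : Fin N → Fin N} → ∀ {h} → Min s h → T (isMin s h)
Min⇒isMin {s = s} {h} m = ≡⇒== (vmin-fix toℕ s h m)

module _ (B : Blocks N) {α β : Fin N → Fin N} (conj : Conj B α β) (injα : Injective _≡_ _≡_ α) where
  private
    module G = Glue B {α} {β} conj injα
    module G′ = Glue (dual B) {β} {α} (conj-dual B {α} {β} conj) G.β-injective
  open G
  open Orbit s-injective using (reach-sym)
  private module Oₜ = Orbit t-injective

  -- The merged vertex is counted at `A`, so `X` and the minimum of the vertex of `C` drop out. The
  -- exchange need not send minima of the other vertices to minima; `vmin` recomputes them in both
  -- directions.
  glue-vertices : Min s A → Min s X → Below s X C → Desc s C →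
                  countB (isMin s) ≡ 2 + countB (isMin t)
  glue-vertices mA mX bel desc =
    trans (count-remove (isMin s) X (Min⇒isMin mX))
      (cong suc (trans (count-remove P₁ mC P₁-mC) (cong suc (count-bijection P₂ (isMin t) f g fwd bwd))))
    where
    open G.Forward mA mX bel desc
    mC = vmin toℕ s C
    C→mC : Reach s C mC
    C→mC = vmin-reach s-injective C
    Min-mC : Min s mC
    Min-mC = vmin-Min s-injective C
    P₁ P₂ : Fin N → Bool
    P₁ h = isMin s h ∧ not (X == h)
    P₂ h = P₁ h ∧ not (mC == h)
    f g : Fin N → Fin N
    f h = vmin toℕ t (sw h)
    g h = vmin toℕ s (G′.sw h)

    P₁-intro : ∀ {h} → Min s h → h ≢ X → T (P₁ h)
    P₁-intro {h} m ne = ∧-intro {isMin s h} (Min⇒isMin m) (not-T (λ p → ne (sym (==⇒≡ X h p))))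
    P₁-mC : T (P₁ mC)
    P₁-mC = P₁-intro Min-mC λ e → C↛X (subst (Reach s C) e C→mC)
    P₂-intro : ∀ {h} → Min s h → h ≢ X → h ≢ mC → T (P₂ h)
    P₂-intro {h} m ne ne′ = ∧-intro {P₁ h} (P₁-intro m ne) (not-T (λ p → ne′ (sym (==⇒≡ mC h p))))
    P₂-elim : ∀ {h} → T (P₂ h) → Min s h × h ≢ X × h ≢ mC
    P₂-elim {h} p with ∧-elim (P₁ h) p
    ... | p₁ , nmC with ∧-elim (isMin s h) p₁
    ... | m , nX = isMin⇒Min s-injective h m
                 , (λ e → T-not nX (≡⇒== {i = X} {h} (sym e)))
                 , (λ e → T-not nmC (≡⇒== {i = mC} {h} (sym e)))

    f-A : f A ≡ A
    f-A = trans (cong (vmin toℕ t) sw-A) (vmin-fix toℕ t A glued-Min-A)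
    g-A : g A ≡ A
    g-A = trans (cong (vmin toℕ s) G′.sw-A) (vmin-fix toℕ s A mA)

    fwd : ∀ {h} → T (P₂ h) → T (isMin t (f h)) × g (f h) ≡ h
    fwd {h} p = Min⇒isMin (vmin-Min t-injective (sw h)) , gf
      where
      mh = proj₁ (P₂-elim p)
      off : h ≢ A → Off h
      off nA r = (λ { refl → nA (Min-unique s-injective mh mA r) })
               , (λ { refl → proj₁ (proj₂ (P₂-elim p)) (Min-unique s-injective mh mX r) })
               , (λ { refl → proj₂ (proj₂ (P₂-elim p)) (Min-unique s-injective mh Min-mC (reach-trans r C→mC)) })
      back : h ≢ A → ∀ {y} → Reach t (sw h) y → Reach s h (G′.sw y)
      back nA (k , refl) = k , sym (trans (cong G′.sw (off-transfer (off nA) k)) (sw-dual B (iter s k h)))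
      go : Dec (h ≡ A) → g (f h) ≡ h
      go (yes refl) = trans (cong g f-A) g-A
      go (no nA) = vmin-unique s-injective mh (reach-sym (back nA (vmin-reach t-injective (sw h))))
      gf : g (f h) ≡ h
      gf = go (h ≟ A)

    bwd : ∀ {h} → T (isMin t h) → T (P₂ (g h)) × f (g h) ≡ h
    bwd {h} q with h ≟ A
    ... | yes refl = subst (T ∘ P₂) (sym g-A) (P₂-intro mA (A≢X B) (λ e → C↛A (subst (Reach s C) (sym e) C→mC)))
                   , trans (cong f g-A) f-A
    ... | no nA = P₂-intro (vmin-Min s-injective (G′.sw h)) gX gmC , fg
      where
      mh = isMin⇒Min t-injective h q
      A↛ : ∀ {y} → Reach t h y → ¬ Reach t y A
      A↛ r r′ = nA (Min-unique t-injective mh glued-Min-A (reach-trans r r′))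
      off : G′.Off h
      off r = (λ { refl → A↛ r reach-refl })
            , (λ { refl → A↛ r C′→A })
            , (λ { refl → A↛ r (Oₜ.reach-sym (path-reach path-A-C)) })
      h→gh : Reach s (G′.sw h) (g h)
      h→gh = vmin-reach s-injective (G′.sw h)
      back : ∀ {y} → Reach s (G′.sw h) y → Reach t h (sw y)
      back (k , refl) = k , sym (trans (cong sw (G′.off-transfer off k)) (sw-dual (dual B) (iter t k h)))
      gX : g h ≢ X
      gX e = proj₂ (proj₂ (off (back (subst (Reach s (G′.sw h)) e h→gh)))) sw-X
      gmC : g h ≢ mC
      gmC e = proj₁ (proj₂ (off (back (reach-trans (subst (Reach s (G′.sw h)) e h→gh) (reach-sym C→mC))))) sw-C
      fg : f (g h) ≡ h
      fg = vmin-unique t-injective mh (Oₜ.reach-sym (back h→gh))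

-- A bound on the number of vertices

module Descents {α : Fin N → Fin N} (inv : ∀ h → α (α h) ≡ h) (fpf : ∀ h → α h ≢ h) where

  private
    s : Fin N → Fin N
    s h = α (next h)
    down up : Fin N → Bool
    down k = toℕ (α k) <ᵇ toℕ k
    up k = toℕ k <ᵇ toℕ (α k)

  involution-injective : Injective _≡_ _≡_ α
  involution-injective {x} {y} eq = trans (sym (inv x)) (trans (cong α eq) (inv y))

  -- The involution pairs every half-edge with a different one, and exactly one of the two is sent
  -- downwards.
  count-down : countB down + countB down ≡ N
  count-down = begin
    countB down + countB down       ≡⟨ cong (countB down +_) (count-bijection down up α α
                                          (λ {h} p → subst (λ z → T (toℕ (α h) <ᵇ toℕ z)) (sym (inv h)) p , inv h)
                                          (λ {h} p → subst (λ z → T (toℕ z <ᵇ toℕ (α h))) (sym (inv h)) p , inv h)) ⟩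
    countB down + countB up         ≡⟨ count-split (λ _ → true) down up split ⟨
    countB {N} (λ _ → true)         ≡⟨ count-all {N} ⟩
    N                               ∎
    where
    open ≡-Reasoning
    split : ∀ h → 1 ≡ ind (down h) + ind (up h)
    split h with down h in d | up h in u
    ... | true | true = contradiction (<ᵇ⇒< _ _ (subst T (sym u) _)) (<-asym (<ᵇ⇒< (toℕ (α h)) _ (subst T (sym d) _)))
    ... | true | false = refl
    ... | false | true = refl
    ... | false | false = contradiction (toℕ-injective (≤-antisym
        (≮⇒≥ (λ lt → subst T u (<⇒<ᵇ lt))) (≮⇒≥ (λ lt → subst T d (<⇒<ᵇ lt))))) (fpf h)

  -- The preimage of the minimum of a vertex is a descent of s, and besides the last half-edge
  -- the descents of s are the predecessors of the k with α k < k.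
  vertices-≤ : (z : Fin N) → toℕ z ≡ 0 → countB (isMin s) ≤ 1 + countB down
  vertices-≤ z z≡0 = begin
    countB (isMin s)                 ≡⟨ count-bijection (isMin s) (isMin s ∘ α) α α
                                          (λ {h} p → subst (T ∘ isMin s) (sym (inv h)) p , inv h)
                                          (λ {h} p → p , inv h) ⟩
    countB (isMin s ∘ α)             ≤⟨ count-≤-+ _ (z ==_) down imp ⟩
    countB (z ==_) + countB down     ≡⟨ cong (_+ countB down) (count-at z) ⟩
    1 + countB down                  ∎
    where
    open ≤-Reasoning
    s-inj : Injective _≡_ _≡_ s
    s-inj = next-injective ∘ involution-injective
    imp : ∀ {k} → T (isMin s (α k)) → T (z == k) ⊎ T (down k)
    imp {k} m with Orbit.preimage next-injective k
    ... | h , refl with isMin⇒Min s-inj (s h) m (Orbit.reach-sym s-inj (1 , refl)) | next-case h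
    ... | le | inj₁ (_ , e) = inj₂ (<⇒<ᵇ (≤-<-trans le (≤-reflexive (sym e))))
    ... | le | inj₂ (_ , e) = inj₁ (≡⇒== (toℕ-injective (trans z≡0 (sym e))))

-- Blocks from positions, and relabelled chords

mkBlocks : (y x c : Fin N) → toℕ y < toℕ x → toℕ x < toℕ c →
           ∃ λ B → Blocks.A B ≡ y × Blocks.X B ≡ x × Blocks.C B ≡ c
mkBlocks {N} y x c y<x x<c with m≤n⇒∃[o]m+o≡n y<x | m≤n⇒∃[o]m+o≡n x<c
... | d , eq | e , eq′ = B , refl , refl , refl
  where
  to-x : toℕ x ≡ toℕ y + suc d
  to-x = trans (sym eq) (sym (+-suc (toℕ y) d))
  to-c : toℕ c ≡ toℕ y + suc d + suc e
  to-c = trans (sym eq′) (trans (cong (λ z → suc (z + e)) to-x) (sym (+-suc _ e)))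
  lt : toℕ y + suc e < N
  lt = ≤-<-trans (≤-trans (+-monoˡ-≤ (suc e) (m≤m+n (toℕ y) (suc d))) (≤-reflexive (sym to-c))) (toℕ<n c)
  B : Blocks N
  B = record { a = toℕ y ; d = d ; e = e ; A = y ; X = x ; C = c ; C′ = fromℕ< lt
             ; toA = refl ; toX = to-x ; toC = to-c ; toC′ = toℕ-fromℕ< lt }

blocks-unique : (B B₂ : Blocks N) →
  Blocks.A B ≡ Blocks.A B₂ → Blocks.X B ≡ Blocks.X B₂ → Blocks.C B ≡ Blocks.C B₂ →
  Blocks.C′ B ≡ Blocks.C′ B₂ × (∀ h → Blocks.sw B h ≡ Blocks.sw B₂ h)
blocks-unique B B₂ refl refl refl = lengths a≡ (suc-injective d≡) (suc-injective e≡)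
  where
  module B = Blocks B
  module B₂ = Blocks B₂
  a≡ : B.a ≡ B₂.a
  a≡ = trans (sym B.toA) B₂.toA
  d≡ : suc B.d ≡ suc B₂.d
  d≡ = +-cancelˡ-≡ B.a _ _ (trans (trans (sym B.toX) B₂.toX) (cong (_+ suc B₂.d) (sym a≡)))
  e≡ : suc B.e ≡ suc B₂.e
  e≡ = +-cancelˡ-≡ (B.a + suc B.d) _ _ (trans (trans (sym B.toC) B₂.toC)
         (cong (_+ suc B₂.e) (sym (cong₂ _+_ a≡ d≡))))
  exchange-cong : ∀ {a d e a′ d′ e′} h → a ≡ a′ → d ≡ d′ → e ≡ e′ →
                  exchange a d e (block a d e h) ≡ exchange a′ d′ e′ (block a′ d′ e′ h)
  exchange-cong h refl refl refl = refl
  lengths : B.a ≡ B₂.a → B.d ≡ B₂.d → B.e ≡ B₂.e → B.C′ ≡ B₂.C′ × (∀ h → B.sw h ≡ B₂.sw h)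
  lengths p q r =
    toℕ-injective (trans B.toC′ (trans (cong₂ (λ a e → a + suc e) p r) (sym B₂.toC′))) ,
    λ h → toℕ-injective (trans (B.toℕ-sw h (block _ _ _ _))
            (trans (exchange-cong (toℕ h) p q r) (sym (B₂.toℕ-sw h (block _ _ _ _)))))

conj-unique : (B B₂ : Blocks N) {α β β₂ : Fin N → Fin N} → (∀ h → Blocks.sw B h ≡ Blocks.sw B₂ h) →
              Conj B α β → Conj B₂ α β₂ → ∀ h → β h ≡ β₂ h
conj-unique B B₂ {α} {β} {β₂} same conj conj₂ h = begin
  β h                 ≡⟨ cong β (sw-dual (dual B) h) ⟨
  β (B.sw k)          ≡⟨ conj k ⟩
  B.sw (α k)          ≡⟨ same (α k) ⟩
  B₂.sw (α k)         ≡⟨ conj₂ k ⟨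
  β₂ (B₂.sw k)        ≡⟨ cong β₂ (same k) ⟨
  β₂ (B.sw k)         ≡⟨ cong β₂ (sw-dual (dual B) h) ⟩
  β₂ h                ∎
  where
  open ≡-Reasoning
  module B = Blocks B
  module B₂ = Blocks B₂
  k = Blocks.sw (dual B) h

ap-injective : {α β : Chord n} → (∀ h → ap α h ≡ ap β h) → α ≡ β
ap-injective {α = chord u} {chord v} eq =
  cong chord (trans (sym (tabulate∘lookup u)) (trans (tabulate-cong eq) (tabulate∘lookup v)))

relabel : Blocks (2 * n) → Chord n → Chord n
relabel B α = chord (tabulate λ k → Blocks.sw B (ap α (Blocks.sw (dual B) k)))

relabel-conj : (B : Blocks (2 * n)) (α : Chord n) → Conj B (ap α) (ap (relabel B α))
relabel-conj B α h =
  trans (lookup∘tabulate (λ k → Blocks.sw B (ap α (Blocks.sw (dual B) k))) (Blocks.sw B h))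
        (cong (Blocks.sw B ∘ ap α) (sw-dual B h))

record Involutive (α : Chord n) : Set where
  field
    involutive : ∀ h → ap α (ap α h) ≡ h
    fixed-point-free : ∀ h → ap α h ≢ h

  ap-inj : Injective _≡_ _≡_ (ap α)
  ap-inj = Descents.involution-injective involutive fixed-point-free

  σ-inj : Injective _≡_ _≡_ (σc α)
  σ-inj = next-injective ∘ ap-inj

open Involutive

toℕ-zeroOf : (h : Fin N) → toℕ (zeroOf h) ≡ 0
toℕ-zeroOf {suc _} _ = refl

numVertices-≤ : {α : Chord n} → Involutive α → HE n → numVertices α ≤ n + 1
numVertices-≤ {n} {α} iα h = ≤-trans (Descents.vertices-≤ (iα .involutive) (iα .fixed-point-free) (zeroOf h) (toℕ-zeroOf h))
  (≤-reflexive (trans (cong suc half) (+-comm 1 n)))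
  where
  m = countB (λ k → toℕ (ap α k) <ᵇ toℕ k)
  half : m ≡ n
  half = *-cancelˡ-≡ m n 2 (trans (cong (m +_) (+-identityʳ m))
           (Descents.count-down (iα .involutive) (iα .fixed-point-free)))

conj-involutive : (B : Blocks (2 * n)) {α β : Chord n} → Conj B (ap α) (ap β) → Involutive α → Involutive β
conj-involutive B {α} {β} conj iα = record
  { involutive = λ h → subst (λ h → ap β (ap β h) ≡ h) (sw-dual (dual B) h) (inv (D.sw h))
  ; fixed-point-free = λ h → subst (λ h → ap β h ≢ h) (sw-dual (dual B) h) (fpf (D.sw h)) }
  where
  open Blocks B
  module D = Blocks (dual B)
  inv : ∀ k → ap β (ap β (sw k)) ≡ sw k
  inv k = trans (cong (ap β) (conj k)) (trans (conj (ap α k)) (cong sw (iα .involutive k)))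
  fpf : ∀ k → ap β (sw k) ≢ sw k
  fpf k eq = iα .fixed-point-free k
    (trans (sym (sw-dual B _)) (trans (cong D.sw (trans (sym (conj k)) eq)) (sw-dual B k)))

-- A single step and its inverse

-- The trisection τ is represented by c = σ(τ): gluing keeps c, whereas it changes σ⁻¹(c) when
-- the vertex of c is a single half-edge.
record Good (α : Chord n) (ws : List (HE n)) (c : HE n) : Set where
  field
    chordal : Involutive α
    minima  : All (Min (σc α)) ws
    sorted  : AllPairs (λ x y → toℕ y < toℕ x) ws
    below   : All (λ w → Below (σc α) w c) ws
    desc    : Desc (σc α) c

open Good

-- A relation, so that gluing, which finds `β` and `c′`, and slicing, which finds `α`, `x`, `y` and
-- `c`, yield the same kind of data. The order `x`, `y` is that of the decreasing list of vertices.
record Step (α : Chord n) (x y c : HE n) (β : Chord n) (c′ : HE n) : Set where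
  field
    B    : Blocks (2 * n)
    is-A : Blocks.A B ≡ y
    is-X : Blocks.X B ≡ x
    is-C : Blocks.C B ≡ c
    is-C′ : Blocks.C′ B ≡ c′
    conj : Conj B (ap α) (ap β)

step-exists : (α : Chord n) {x y c : HE n} → toℕ y < toℕ x → toℕ x < toℕ c →
              ∃ λ β → ∃ λ c′ → Step α x y c β c′
step-exists α {x} {y} {c} y<x x<c with mkBlocks y x c y<x x<c
... | B , eA , eX , eC = relabel B α , Blocks.C′ B , record
  { B = B ; is-A = eA ; is-X = eX ; is-C = eC ; is-C′ = refl ; conj = relabel-conj B α }

step-deterministic : {α β β₂ : Chord n} {x y c c′ c₂′ : HE n} →
  Step α x y c β c′ → Step α x y c β₂ c₂′ → β ≡ β₂ × c′ ≡ c₂′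
step-deterministic {α = α} {β} {β₂}
  record { B = B ; is-A = refl ; is-X = refl ; is-C = refl ; is-C′ = refl ; conj = conj }
  record { B = B₂ ; is-A = eA ; is-X = eX ; is-C = eC ; is-C′ = refl ; conj = conj₂ }
  with blocks-unique B B₂ (sym eA) (sym eX) (sym eC)
... | eC′ , same = ap-injective (conj-unique B B₂ {ap α} {ap β} {ap β₂} same conj conj₂) , eC′

module _ {α β : Chord n} {x y c c′ : HE n} {ws : List (HE n)}
         (good : Good α (x ∷ y ∷ ws) c) (st : Step α x y c β c′) where
  open Step st

  module StepGlue where
    open Glue B {ap α} {ap β} conj (ap-inj (chordal good)) public
    open Forward
      (subst (Min s) (sym is-A) (All.head (All.tail (minima good))))
      (subst (Min s) (sym is-X) (All.head (minima good)))
      (subst₂ (Below s) (sym is-X) (sym is-C) (All.head (below good)))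
      (subst (Desc s) (sym is-C) (desc good)) public

  open StepGlue hiding (C′; C; X; A; c<N)

  step-A-Min : Min (σc β) y
  step-A-Min = subst (Min (σc β)) is-A glued-Min-A

  step-reach : Reach (σc β) c′ y
  step-reach = subst₂ (Reach (σc β)) is-C′ is-A C′→A

  step-< : toℕ y < toℕ c′
  step-< = subst₂ (λ i j → toℕ i < toℕ j) is-A is-C′ A<C′

  step-smallest : Smallest {s = σc β} {c′} y c
  step-smallest = helper is-A is-C is-C′
    where
    helper : ∀ {y c c′} → Blocks.A B ≡ y → Blocks.C B ≡ c → Blocks.C′ B ≡ c′ → Smallest {s = σc β} {c′} y c
    helper refl refl refl = path-A-C , C′<C , C-smallest

  -- `c′` shares its vertex with the smaller `y`. This marks the start of a chain: a state whose `c`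
  -- is a minimum has no predecessor.
  step-not-Min : ¬ Min (σc β) c′
  step-not-Min m = <⇒≱ step-< (m step-reach)

  step-good : Good β ws c′
  step-good = record
    { chordal = conj-involutive B conj (chordal good)
    ; minima  = All.zipWith (λ {w} → keep-Min {w}) (All.tail (All.tail (minima good)) , lower)
    ; sorted  = drop₂ (sorted good)
    ; below   = All.map (λ {w} → keep-Below {w}) lower
    ; desc    = subst (Desc (σc β)) is-C′ glued-Desc }
    where
    keep-Min : ∀ {w} → Min (σc α) w × toℕ w < toℕ y → Min (σc β) w
    keep-Min {w} (m , lt) = Min-below m (subst (λ z → toℕ w < toℕ z) (sym is-A) lt)
    keep-Below : ∀ {w} → toℕ w < toℕ y → Below (σc β) w c′
    keep-Below lt {v} r = <-≤-trans lt (subst (λ z → toℕ z ≤ toℕ v) is-A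
      (glued-≥ (subst (λ z → Reach (σc β) z v) (sym is-C′) r)))
    lower : All (λ w → toℕ w < toℕ y) ws
    lower with sorted good
    ... | _ ∷ lt ∷ _ = lt
    drop₂ : ∀ {x y ws} → AllPairs (λ x y → toℕ y < toℕ x) (x ∷ y ∷ ws) → AllPairs (λ x y → toℕ y < toℕ x) ws
    drop₂ (_ ∷ _ ∷ p) = p

  step-vertices : numVertices α ≡ 2 + numVertices β
  step-vertices = glue-vertices B {ap α} {ap β} conj (ap-inj (chordal good))
      (subst (Min s) (sym is-A) (All.head (All.tail (minima good))))
      (subst (Min s) (sym is-X) (All.head (minima good)))
      (subst₂ (Below s) (sym is-X) (sym is-C) (All.head (below good)))
      (subst (Desc s) (sym is-C) (desc good))

step-injective : {α α₂ β : Chord n} {x x₂ y y₂ c c₂ c′ : HE n} {ws ws₂ : List (HE n)} →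
  Good α (x ∷ y ∷ ws) c → Good α₂ (x₂ ∷ y₂ ∷ ws₂) c₂ →
  Step α x y c β c′ → Step α₂ x₂ y₂ c₂ β c′ → α ≡ α₂ × x ≡ x₂ × y ≡ y₂ × c ≡ c₂
step-injective {α = α} {α₂} {β} {x} {x₂} {y} {y₂} {c} {c₂} {c′} good good₂ st st₂ =
  ap-injective (conj-unique (dual S.B) (dual S₂.B) {ap β} {ap α} {ap α₂} (proj₂ uniq)
    (conj-dual S.B {ap α} {ap β} S.conj) (conj-dual S₂.B {ap α₂} {ap β} S₂.conj))
  , trans (sym S.is-X) (trans (proj₁ uniq) S₂.is-X) , y≡ , c≡
  where
  module S = Step st
  module S₂ = Step st₂
  β-inj : Injective _≡_ _≡_ (σc β)
  β-inj = σ-inj (chordal (step-good good st))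
  y≡ : y ≡ y₂
  y≡ = Min-unique β-inj (step-A-Min good st) (step-A-Min good₂ st₂)
    (reach-trans (Orbit.reach-sym β-inj (step-reach good st)) (step-reach good₂ st₂))
  least : ∀ {y c c₂} → Smallest {s = σc β} {c′} y c → Smallest {s = σc β} {c′} y c₂ → toℕ c ≤ toℕ c₂
  least (_ , _ , l) (p , lt , _) = l p lt
  sm = step-smallest good st
  sm₂ = subst (λ y → Smallest {s = σc β} {c′} y c₂) (sym y≡) (step-smallest good₂ st₂)
  c≡ : c ≡ c₂
  c≡ = toℕ-injective (≤-antisym (least sm sm₂) (least sm₂ sm))
  -- Once `y`, `c′` and `c` agree, so do the dual blocks; their fourth position is `x`.
  uniq = blocks-unique (dual S.B) (dual S₂.B) (trans S.is-A (trans y≡ (sym S₂.is-A)))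
    (trans S.is-C′ (sym S₂.is-C′)) (trans S.is-C (trans c≡ (sym S₂.is-C)))

slice : {β : Chord n} {ws : List (HE n)} {c′ : HE n} → Good β ws c′ → ¬ Min (σc β) c′ →
  ∃ λ α → ∃ λ x → ∃ λ y → ∃ λ c → Step α x y c β c′ × Good α (x ∷ y ∷ ws) c
slice {n} {β} {ws} {c′} good ¬m = result
  where
  inj = σ-inj (chordal good)
  open Orbit inj
  s = σc β
  y = vmin toℕ s c′
  y-Min : Min s y
  y-Min = vmin-Min inj c′
  y→c′ : Reach s y c′
  y→c′ = reach-sym (vmin-reach inj c′)
  y≢c′ : y ≢ c′
  y≢c′ e = ¬m (subst (Min s) e y-Min)
  y<c′ : toℕ y < toℕ c′
  y<c′ = ≤∧≢⇒< (y-Min y→c′) (y≢c′ ∘ toℕ-injective)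
  path : Path s c′ y c′
  path = path-to (proj₁ y→c′) (proj₂ y→c′)
  τ = proj₁ (desc good)
  sτ = proj₁ (proj₂ (desc good))
  c′<τ : toℕ c′ < toℕ τ
  -- Equality would make `c′` a vertex by itself, hence a minimum.
  c′<τ = ≤∧≢⇒< (proj₂ (proj₂ (desc good))) λ e → fixed (toℕ-injective e)
    where
    fixed : c′ ≢ τ
    fixed e = y≢c′ (reach-invariant (_≡ c′) (λ { refl → trans (cong s e) sτ }) (reach-sym y→c′) refl)
  result : ∃ λ α → ∃ λ x → ∃ λ y → ∃ λ c → Step α x y c β c′ × Good α (x ∷ y ∷ ws) c
  result with smallest-on-path path
  -- The search cannot fail: `τ` precedes `c′` on the path and exceeds it.
  ... | inj₁ none = contradiction c′<τ (none (path-pred inj sτ y≢c′ path))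
  ... | inj₂ (c , sm) with mkBlocks y c′ c y<c′ (proj₁ (proj₂ sm))
  -- `B` is cut on the face of `β`, so its `X` is `c′` and the new `x` appears at `C′`. The step
  -- from `α` back to `β` uses `dual B`.
  ... | B , eA , eX , refl = α , C′ , A , C , st , record
    { chordal = conj-involutive B {β} {α} (relabel-conj B β) (chordal good)
    ; minima  = sliced-Min-C′ ∷ sliced-Min-A ∷ All.zipWith (λ {w} → keep-Min {w}) (minima good , below good)
    ; sorted  = (A<C′ ∷ All.map (λ lt → <-trans lt A<C′) lowers)
                ∷ lowers ∷ sorted good
    ; below   = sliced-Below ∷ (λ r → <-trans A<C′ (sliced-Below r)) ∷
                All.map (λ {w} → keep-Below {w}) lowers
    ; desc    = sliced-Desc }
    where
    α : Chord n
    α = relabel B β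
    open Glue B {ap β} {ap α} (relabel-conj B β) (ap-inj (chordal good)) hiding (s)
    bel : ∀ {w} → Below s w c′ → Below s w X
    bel b r = b (subst (λ z → Reach s z _) eX r)
    transport : ∀ {c″} → X ≡ c″ → Smallest {s = s} {c″} y C → Smallest {s = s} {X} A C
    transport refl sm = subst (λ z → Smallest {s = s} {X} z C) (sym eA) sm
    open Slice (subst (Min s) (sym eA) y-Min) (subst₂ (Reach s) (sym eA) (sym eX) y→c′)
               (transport eX sm) (subst (Desc s) (sym eX) (desc good))
    lower : ∀ {w} → Below s w c′ → toℕ w < toℕ A
    lower b = below-A (bel b)
    lowers : All (λ w → toℕ w < toℕ A) ws
    lowers = All.map (λ {w} → lower {w}) (below good)
    keep-Below : ∀ {w} → toℕ w < toℕ A → Below (σc α) w C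
    keep-Below lt r = <-trans lt (<-trans A<C′ (sliced-Below r))
    keep-Min : ∀ {w} → Min s w × Below s w c′ → Min (σc α) w
    keep-Min (m , b) = Min-below m (bel b)
    st : Step α C′ A C β c′
    st = record { B = dual B ; is-A = refl ; is-X = refl ; is-C = refl ; is-C′ = eX
                ; conj = conj-dual B {ap β} {ap α} (relabel-conj B β) }

-- Chains of gluings

State : ℕ → Set
State n = Chord n × List (HE n) × HE n

GoodState : State n → Set
GoodState (α , ws , c) = Good α ws c

data Run {n : ℕ} : State n → State n → Set where
  done : ∀ {S} → Run S S
  _then_ : ∀ {α β x y c c′ ws T} → Step α x y c β c′ → Run (β , ws , c′) T →
           Run (α , x ∷ y ∷ ws , c) T

run-good : {S T : State n} → GoodState S → Run S T → GoodState T
run-good good done = good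
run-good good (st then run) = run-good (step-good good st) run

run-vertices : {α β : Chord n} {ws : List (HE n)} {c c′ : HE n} → Good α ws c →
               Run (α , ws , c) (β , [] , c′) → numVertices α ≡ length ws + numVertices β
run-vertices good done = refl
run-vertices good (st then run) =
  trans (step-vertices good st) (cong (2 +_) (run-vertices (step-good good st) run))

run-deterministic : {S : State n} {β β₂ : Chord n} {c c₂ : HE n} →
                    Run S (β , [] , c) → Run S (β₂ , [] , c₂) → β ≡ β₂ × c ≡ c₂
run-deterministic done done = refl , refl
run-deterministic (st then run) (st₂ then run₂) with step-deterministic st st₂
... | refl , refl = run-deterministic run run₂

-- A run is built from its front, but a step is determined by its result; comparing runs with a
-- common end requires access to the last step.
data Last {n : ℕ} (S : State n) : State n → Set where
  none : Last S S
  last : ∀ {α β x y c c′ ws} → Run S (α , x ∷ y ∷ ws , c) → Step α x y c β c′ →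
         Last S (β , ws , c′)

run-last : {S T : State n} → Run S T → Last S T
run-last done = none
run-last (st then run) with run-last run
... | none = last done st
... | last run′ st′ = last (st then run′) st′

step-comparable : ∀ {α β : Chord n} {x y c c′ ws S} → Step α x y c β c′ → Good α (x ∷ y ∷ ws) c →
  GoodState S → Last S (β , ws , c′) → Run (α , x ∷ y ∷ ws , c) S ⊎ Run S (α , x ∷ y ∷ ws , c)
step-comparable st good good₂ none = inj₁ (st then done)
step-comparable {n} {ws = ws} {S} st good good₂ (last run st₂) =
  inj₂ (same run (step-injective good (run-good good₂ run) st st₂))
  where
  same : ∀ {α α₂ : Chord n} {x x₂ y y₂ c c₂} → Run S (α₂ , x₂ ∷ y₂ ∷ ws , c₂) →
         α ≡ α₂ × x ≡ x₂ × y ≡ y₂ × c ≡ c₂ → Run S (α , x ∷ y ∷ ws , c)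
  same run (refl , refl , refl , refl) = run

-- Injectivity of steps makes the way back from `T` unique, so the shorter run is a tail of the
-- longer. The lengths may differ because the starting genus is not fixed.
run-comparable : {S S₂ T : State n} → GoodState S → GoodState S₂ → Run S T → Run S₂ T →
                 Run S S₂ ⊎ Run S₂ S
run-comparable good good₂ done run₂ = inj₂ run₂
run-comparable good good₂ (st then run) run₂ =
  Sum.[ (λ r → inj₁ (st then r)) , (λ r → step-comparable st good good₂ (run-last r)) ]′
    (run-comparable (step-good good st) good₂ run run₂)

run-to-Min : {S : State n} {α : Chord n} {ws : List (HE n)} {c : HE n} →
             GoodState S → Run S (α , ws , c) → Min (σc α) c → S ≡ (α , ws , c)
run-to-Min good run m = go (run-last run) m
  where
  go : ∀ {α ws c} → Last _ (α , ws , c) → Min (σc α) c → _ ≡ (α , ws , c)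
  go none m = refl
  go (last run′ st) m = ⊥-elim (step-not-Min (run-good good run′) st m)

run-snoc : ∀ {S : State n} {α β x y c c′ ws} → Run S (α , x ∷ y ∷ ws , c) → Step α x y c β c′ →
           Run S (β , ws , c′)
run-snoc done st = st then done
run-snoc (st′ then run) st = st′ then run-snoc run st

genus-pred : ∀ {u v m} g → u ≡ 2 + v → v + 2 * suc g ≡ m → u + 2 * g ≡ m
genus-pred {v = v} g refl refl = begin
  2 + v + 2 * g       ≡⟨ cong (_+ 2 * g) (+-comm 2 v) ⟩
  v + 2 + 2 * g       ≡⟨ +-assoc v 2 (2 * g) ⟩
  v + (2 + 2 * g)     ≡⟨ cong (v +_) (*-suc 2 g) ⟨
  v + 2 * suc g       ∎
  where open ≡-Reasoning

Min? : {s : Fin N → Fin N} → Injective _≡_ _≡_ s → ∀ h → Dec (Min s h)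
Min? {s = s} inj h = Dec.map′ (λ e → subst (Min s) e (vmin-Min inj h)) (vmin-fix toℕ s h) (vmin toℕ s h ≟ h)

-- The genus is the fuel: two more vertices lower it by one. In genus `0` there are already `n + 1`
-- vertices, so no slice is possible.
slice-all : (g : ℕ) {β : Chord n} {ws : List (HE n)} {c′ : HE n} →
  Good β ws c′ → ¬ Min (σc β) c′ → numVertices β + 2 * g ≡ n + 1 →
  ∃ λ p → p < g × ∃ λ α → ∃ λ vs → ∃ λ c →
    Run (α , vs , c) (β , ws , c′) × Good α vs c × Min (σc α) c × numVertices α + 2 * p ≡ n + 1
slice-all {n} zero {β} good ¬m eq =
  let α , x , y , c , st , good′ = slice good ¬m in
  contradiction (begin-strict
    numVertices β           <⟨ m<n+m _ (s≤s z≤n) ⟩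
    2 + numVertices β       ≡⟨ step-vertices good′ st ⟨
    numVertices α           ≤⟨ numVertices-≤ (chordal good′) c ⟩
    n + 1                   ≡⟨ eq ⟨
    numVertices β + 0       ≡⟨ +-identityʳ _ ⟩
    numVertices β           ∎) (<-irrefl refl)
  where open ≤-Reasoning
slice-all {n} (suc g) {β} {ws} {c′} good ¬m eq =
  let α , x , y , c , st , good′ = slice good ¬m in
  go st good′ (genus-pred g (step-vertices good′ st) eq) (Min? (σ-inj (chordal good′)) c)
  where
  go : ∀ {α x y c} → Step α x y c β c′ → Good α (x ∷ y ∷ ws) c → numVertices α + 2 * g ≡ n + 1 →
       Dec (Min (σc α) c) → ∃ λ p → p < suc g × ∃ λ α → ∃ λ vs → ∃ λ c →
         Run (α , vs , c) (β , ws , c′) × Good α vs c × Min (σc α) c × numVertices α + 2 * p ≡ n + 1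
  go st good′ genus (yes m) = g , ≤-refl , _ , _ , _ , (st then done) , good′ , m , genus
  go st good′ genus (no ¬m′) =
    let p , p<g , α , vs , c , run , rest = slice-all g good′ ¬m′ genus
    in p , m≤n⇒m≤1+n p<g , α , vs , c , run-snoc run st , rest

-- Canonical labellings of the maps occurring in Λ

-- Relates a map with the original half-edge names to its canonical form `β`. It asks only for an
-- isomorphism that respects the root; that `pos` is the position along the face then follows.
record Labelling {n} (a s : HE n → HE n) (r : HE n) (β : Chord n) : Set where
  field
    pos at : HE n → HE n
    at-pos : ∀ h → at (pos h) ≡ h
    pos-at : ∀ k → pos (at k) ≡ k
    pos-a  : ∀ h → pos (a h) ≡ ap β (pos h)
    pos-s  : ∀ h → pos (s h) ≡ σc β (pos h)
    pos-r  : toℕ (pos r) ≡ 0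

  γ : HE n → HE n
  γ h = a (s h)

  pos-injective : Injective _≡_ _≡_ pos
  pos-injective {x} {y} eq = trans (sym (at-pos x)) (trans (cong at eq) (at-pos y))

toℕ-iter-next : (z : Fin N) → toℕ z ≡ 0 → ∀ k → k < N → toℕ (iter next k z) ≡ k
toℕ-iter-next z z≡0 zero _ = z≡0
toℕ-iter-next {N} z z≡0 (suc k) lt =
  trans (toℕ-next-< _ (subst (λ m → suc m < N) (sym ih) lt)) (cong suc ih)
  where ih = toℕ-iter-next z z≡0 k (<-trans (n<1+n k) lt)

module _ {a s : HE n → HE n} {r : HE n} {β : Chord n} (iβ : Involutive β)
         (lab : Labelling a s r β) where
  open Labelling lab

  pos-γ : ∀ h → pos (γ h) ≡ next (pos h)
  pos-γ h = trans (pos-a (s h)) (trans (cong (ap β) (pos-s h)) (iβ .involutive _))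

  pos-iter : ∀ k → pos (iter γ k r) ≡ iter next k (pos r)
  pos-iter zero = refl
  pos-iter (suc k) = trans (pos-γ _) (cong next (pos-iter k))

  pos-iter-γ : ∀ k → pos (iter γ (toℕ k) r) ≡ k
  pos-iter-γ k = toℕ-injective
    (trans (cong toℕ (pos-iter (toℕ k))) (toℕ-iter-next (pos r) pos-r (toℕ k) (toℕ<n k)))

  -- The `k`-th half-edge after the root has label `k`, so the search in `posF` has exactly one hit.
  posF≡pos : ∀ h → posF γ r h ≡ pos h
  posF≡pos h = foldr-find (λ k → iter γ (toℕ k) r == h) r (allFin (2 * n)) (∈-allFin (pos h))
    (≡⇒== (pos-injective (pos-iter-γ (pos h))))
    (λ {k} p → trans (sym (pos-iter-γ k)) (cong pos (==⇒≡ (iter γ (toℕ k) r) h p)))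

  canon≡ : canon {n} a s r ≡ β
  canon≡ = ap-injective λ k → begin
    ap (canon {n} a s r) k                   ≡⟨ lookup∘tabulate (λ k → posF γ r (a (iter γ (toℕ k) r))) k ⟩
    posF γ r (a (iter γ (toℕ k) r))          ≡⟨ posF≡pos _ ⟩
    pos (a (iter γ (toℕ k) r))               ≡⟨ pos-a _ ⟩
    ap β (pos (iter γ (toℕ k) r))            ≡⟨ cong (ap β) (pos-iter-γ k) ⟩
    ap β k                                   ∎
    where open ≡-Reasoning

  vmin≡ : ∀ {v} → Min (σc β) (pos v) → vmin (key a s r) s v ≡ v
  vmin≡ {v} m = vmin-fix (key a s r) s v λ { {y} (k , refl) →
    subst₂ _≤_ (sym (cong toℕ (posF≡pos v))) (sym (cong toℕ (posF≡pos y))) (m (k , sym (pos-iter-s k))) }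
    where
    pos-iter-s : ∀ k → pos (iter s k v) ≡ iter (σc β) k (pos v)
    pos-iter-s zero = refl
    pos-iter-s (suc k) = trans (pos-s _) (cong (σc β) (pos-iter-s k))

  -- The new labels are the old ones followed by the exchange. Labels up to `y` stay, which protects
  -- the vertices that later rounds will glue.
  glue-labelling : ∀ {β′ x y c c′ v₁ v₂ v₃} → Step β x y c β′ c′ →
    pos v₁ ≡ y → pos v₂ ≡ x → pos v₃ ≡ c →
    Σ (Labelling a (glue s v₁ v₂ v₃) r β′) λ lab′ →
      Labelling.pos lab′ v₃ ≡ c′ × (∀ {w} → toℕ (pos w) ≤ toℕ y → Labelling.pos lab′ w ≡ pos w)
  glue-labelling {β′} {v₁ = v₁} {v₂} {v₃}
    record { B = B ; is-A = refl ; is-X = refl ; is-C = refl ; is-C′ = refl ; conj = conj } e₁ e₂ e₃ =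
    record
      { pos = sw ∘ pos
      ; at = at ∘ D.sw
      ; at-pos = λ h → trans (cong at (sw-dual B (pos h))) (at-pos h)
      ; pos-at = λ k → trans (cong sw (pos-at (D.sw k))) (sw-dual (dual B) k)
      ; pos-a = λ h → trans (cong sw (pos-a h)) (sym (conj (pos h)))
      ; pos-s = glued
      ; pos-r = trans (cong toℕ (sw-low (subst (_≤ toℕ A) (sym pos-r) z≤n))) pos-r }
    , trans (cong sw e₃) sw-C , sw-low
    where
    open Glue B {ap β} {ap β′} conj (ap-inj iβ) hiding (s)
    module D = Blocks (dual B)
    off : ∀ {h v z} → h ≢ v → pos v ≡ z → pos h ≢ z
    off ne e e′ = ne (pos-injective (trans e′ (sym e)))
    glued : ∀ h → sw (pos (glue s v₁ v₂ v₃ h)) ≡ t (sw (pos h))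
    glued h with h ≟ v₁ | h ≟ v₂ | h ≟ v₃
    ... | yes refl | _ | _ = trans (cong sw (trans (pos-s v₂) (cong (σc β) e₂)))
                               (sym (trans (cong (t ∘ sw) e₁) (trans (cong t sw-A) t-A)))
    ... | no _ | yes refl | _ = trans (cong sw (trans (pos-s v₃) (cong (σc β) e₃)))
                               (sym (trans (cong (t ∘ sw) e₂) (trans (cong t sw-X) t-C)))
    ... | no _ | no _ | yes refl = trans (cong sw (trans (pos-s v₁) (cong (σc β) e₁)))
                               (sym (trans (cong (t ∘ sw) e₃) (trans (cong t sw-C) t-C′)))
    ... | no n₁ | no n₂ | no n₃ = trans (cong sw (pos-s h)) (sym (t-other (off n₁ e₁) (off n₂ e₂) (off n₃ e₃)))

glue-other : {s : Fin N → Fin N} {v₁ v₂ v₃ h : Fin N} → h ≢ v₁ → h ≢ v₂ → h ≢ v₃ → glue s v₁ v₂ v₃ h ≡ s h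
glue-other n₁ n₂ n₃ rewrite ≢⇒==false n₁ | ≢⇒==false n₂ | ≢⇒==false n₃ = refl

Result : (a : HE n → HE n) (r : HE n) → (HE n → HE n) × HE n → Chord n × HE n
Result a r (s , τ) = canon a s r , posF (λ h → a (s h)) r τ

-- With `¬ Min`, this makes `τ` a trisection up to the descent at `c′`, which `Good` supplies at the
-- end of the run.
Computes : (S : State n) → Chord n × HE n → Set
Computes S (β , τ) = ∃ λ c′ → Run S (β , [] , c′) × ¬ Min (σc β) c′ × σc β τ ≡ c′

-- The invariant is that remaining vertices have their names as labels and that `s τ` has label `c`.
-- The length is `m * 2` so that a round removes two by mere computation.
loop-computes : ∀ m {a s : HE n → HE n} {r τ : HE n} {β : Chord n} {ws : List (HE n)} {c : HE n} →
  length ws ≡ m * 2 → Good β ws c → ¬ Min (σc β) c →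
  (lab : Labelling a s r β) → All (λ w → Labelling.pos lab w ≡ w) ws →
  σc β (Labelling.pos lab τ) ≡ c →
  Computes (β , ws , c) (Result a r (ΨLoop a r s τ (revPairs ws)))
loop-computes m {a} {s} {r} {τ} {β} {[]} {c} _ good ¬m lab _ eq =
  subst (Computes (β , [] , c)) (sym (cong₂ _,_ (canon≡ (chordal good) lab) (posF≡pos (chordal good) lab τ)))
    (c , done , ¬m , eq)
loop-computes (suc m) {a} {s} {r} {τ} {β} {x ∷ y ∷ ws} {c} len good ¬m lab (fx ∷ fy ∷ fws) eq =
  extend (step-exists β y<x x<head)
  where
  open Labelling lab
  iβ = chordal good
  y<x : toℕ y < toℕ x
  y<x with sorted good
  ... | (lt ∷ _) ∷ _ = lt
  x<head : toℕ x < toℕ c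
  x<head = All.head (below good) reach-refl
  y-Min : Min (σc β) y
  y-Min = All.head (All.tail (minima good))
  x-Min : Min (σc β) x
  x-Min = All.head (minima good)
  vy : vmin (key a s r) s y ≡ y
  vy = vmin≡ iβ lab (subst (Min (σc β)) (sym fy) y-Min)
  vx : vmin (key a s r) s x ≡ x
  vx = vmin≡ iβ lab (subst (Min (σc β)) (sym fx) x-Min)
  pos-sτ : pos (s τ) ≡ c
  pos-sτ = trans (pos-s τ) eq
  τ-off : ∀ {w} → pos w ≡ w → Below (σc β) w c → τ ≢ w
  τ-off {w} fw bel refl = <-irrefl refl (bel (Orbit.reach-sym (σ-inj iβ) {w} {c}
    (1 , trans (cong (σc β) (sym fw)) eq)))
  τ-not-c : τ ≢ s τ
  τ-not-c e = ¬m λ r → ≤-reflexive (sym (cong toℕ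
    (reach-invariant (_≡ c) (λ { refl → trans (cong (σc β) (trans (sym pos-sτ) (cong pos (sym e)))) eq }) r refl)))
  -- Ψ leaves the image of `τ` alone: `τ` lies in the vertex of `c`, which avoids `x` and `y`, and
  -- `τ = s τ` would make `c` a minimum.
  keeps : glue s y x (s τ) τ ≡ s τ
  keeps = glue-other (τ-off fy (λ r → All.head (All.tail (below good)) r))
                     (τ-off fx (λ r → All.head (below good) r)) τ-not-c
  extend : (∃ λ β′ → ∃ λ c′ → Step β x y c β′ c′) →
           Computes (β , x ∷ y ∷ ws , c)
             (Result a r (ΨLoop a r (glue s (vmin (key a s r) s y) (vmin (key a s r) s x) (s τ)) τ (revPairs ws)))
  extend (β′ , c′ , st) rewrite vy | vx = add (loop-computes m (suc-injective (suc-injective len))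
      (step-good good st) (step-not-Min good st) lab′ fixed
      (trans (sym (Labelling.pos-s lab′ τ)) (trans (cong (Labelling.pos lab′) keeps) (proj₁ (proj₂ gl)))))
    where
    gl = glue-labelling iβ lab st fy fx pos-sτ
    lab′ = proj₁ gl
    lower : All (λ w → toℕ w < toℕ y) ws
    lower with sorted good
    ... | _ ∷ lt ∷ _ = lt
    fixed : All (λ w → Labelling.pos lab′ w ≡ w) ws
    fixed = All.zipWith (λ (fw , lt) → trans (proj₂ (proj₂ gl) (subst (λ z → toℕ z ≤ toℕ y) (sym fw) (<⇒≤ lt))) fw)
              (fws , lower)
    add : ∀ {out} → Computes (β′ , ws , c′) out → Computes (β , x ∷ y ∷ ws , c) out
    add (c″ , run , rest) = c″ , (st then run) , rest

ΛRaw-unfold : ∀ {k} (α : Chord n) (ws : Vec (HE n) (suc k)) {c b a rest} →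
  reverse (toList ws) ≡ c ∷ b ∷ a ∷ rest →
  let r = zeroOf c
      v = vmin (key (ap α) (σc α) r) (σc α)
      s₁ = glue (σc α) (v a) (v b) (v c)
  in ΛRaw α ws ≡ Result (ap α) r (ΨLoop (ap α) r s₁ (preim s₁ (v c)) (revPairs rest))
ΛRaw-unfold α ws eq with reverse (toList ws) | eq
... | _ | refl = refl

ΛRaw-computes : ∀ {k} m (α : Chord n) (ws : Vec (HE n) (suc k)) {c b a rest} →
  reverse (toList ws) ≡ c ∷ b ∷ a ∷ rest → length rest ≡ m * 2 →
  Good α (b ∷ a ∷ rest) c → Min (σc α) c → Computes (α , b ∷ a ∷ rest , c) (ΛRaw α ws)
ΛRaw-computes {n} m α ws {c} {b} {a} {rest} eq len good c-Min =
  subst (Computes _) (sym (ΛRaw-unfold α ws eq)) (extend (step-exists α a<b b<c))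
  where
  iα = chordal good
  r = zeroOf c
  lab : Labelling (ap α) (σc α) r α
  lab = record { pos = id ; at = id ; at-pos = λ _ → refl ; pos-at = λ _ → refl
               ; pos-a = λ _ → refl ; pos-s = λ _ → refl ; pos-r = toℕ-zeroOf c }
  a<b : toℕ a < toℕ b
  a<b with sorted good
  ... | (lt ∷ _) ∷ _ = lt
  b<c : toℕ b < toℕ c
  b<c = All.head (below good) reach-refl
  v = vmin (key (ap α) (σc α) r) (σc α)
  va : v a ≡ a
  va = vmin≡ iα lab (All.head (All.tail (minima good)))
  vb : v b ≡ b
  vb = vmin≡ iα lab (All.head (minima good))
  vc : v c ≡ c
  vc = vmin≡ iα lab c-Min
  extend : (∃ λ β → ∃ λ c′ → Step α b a c β c′) →
    let s₁ = glue (σc α) (v a) (v b) (v c)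
    in Computes (α , b ∷ a ∷ rest , c) (Result (ap α) r (ΨLoop (ap α) r s₁ (preim s₁ (v c)) (revPairs rest)))
  extend (β , c′ , st) rewrite va | vb | vc = add (loop-computes m len (step-good good st) (step-not-Min good st)
      lab′ fixed (trans (sym (Labelling.pos-s lab′ τ)) (trans (cong (Labelling.pos lab′) s₁τ) (proj₁ (proj₂ gl)))))
    where
    s₁ = glue (σc α) a b c
    τ = preim s₁ c
    gl = glue-labelling iα lab st refl refl refl
    lab′ : Labelling (ap α) s₁ r β
    lab′ = proj₁ gl
    -- Needed for `preim` to find a preimage; it is pulled back from `σc β` along `pos`.
    s₁-inj : Injective _≡_ _≡_ s₁
    s₁-inj {x} {y} e = pos-injective (σ-inj (chordal (step-good good st))
        (trans (sym (pos-s x)) (trans (cong pos e) (pos-s y))))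
      where open Labelling lab′
    s₁τ : s₁ τ ≡ c
    s₁τ = preim-correct s₁-inj c
    lower : All (λ w → toℕ w < toℕ a) rest
    lower with sorted good
    ... | _ ∷ lt ∷ _ = lt
    fixed : All (λ w → Labelling.pos lab′ w ≡ w) rest
    fixed = All.map (λ lt → proj₂ (proj₂ gl) (<⇒≤ lt)) lower
    add : ∀ {out} → Computes (β , rest , c′) out → Computes (α , b ∷ a ∷ rest , c) out
    add (c″ , run , more) = c″ , (st then run) , more

-- The Boolean definitions

isChord⇒Involutive : (α : Chord n) → T (isChord α) → Involutive α
isChord⇒Involutive {n} α p = record
  { involutive = λ h → ==⇒≡ _ _ (proj₁ (at h))
  ; fixed-point-free = λ h e → T-not {ap α h == h} (proj₂ (at h)) (≡⇒== e) }
  where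
  at : ∀ h → T (ap α (ap α h) == h) × T (not (ap α h == h))
  at h = ∧-elim (ap α (ap α h) == h) (All.lookup (all⁺ _ (allFin (2 * n)) p) (∈-allFin h))

Involutive⇒isChord : {α : Chord n} → Involutive α → T (isChord α)
Involutive⇒isChord {n} {α} iα = all⁻ _ {xs = allFin (2 * n)} (All.tabulate λ {h} _ →
  ∧-intro {ap α (ap α h) == h} (≡⇒== (iα .involutive h))
    (not-T λ e → iα .fixed-point-free h (==⇒≡ (ap α h) h e)))

_<ᶠ_ : Fin N → Fin N → Set
i <ᶠ j = toℕ i < toℕ j

strictlySorted⇒Linked : (xs : List (Fin N)) → T (strictlySorted xs) → Linked _<ᶠ_ xs
strictlySorted⇒Linked [] p = []
strictlySorted⇒Linked (x ∷ []) p = [-]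
strictlySorted⇒Linked (x ∷ y ∷ xs) p =
  <ᵇ⇒< _ _ (proj₁ (∧-elim (toℕ x <ᵇ toℕ y) p)) ∷
  strictlySorted⇒Linked (y ∷ xs) (proj₂ (∧-elim (toℕ x <ᵇ toℕ y) p))

Linked⇒strictlySorted : {xs : List (Fin N)} → Linked _<ᶠ_ xs → T (strictlySorted xs)
Linked⇒strictlySorted [] = _
Linked⇒strictlySorted [-] = _
Linked⇒strictlySorted (lt ∷ l) = ∧-intro (<⇒<ᵇ lt) (Linked⇒strictlySorted l)

reverse-All : {P : E → Set} {xs : List E} → All P xs → All P (reverse xs)
reverse-All ps = All.tabulate (All.lookup ps ∘ reverse⁻)

reverse-AllPairs : {R : E → E → Set} {xs : List E} → AllPairs R xs → AllPairs (flip R) (reverse xs)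
reverse-AllPairs [] = []
reverse-AllPairs {R = R} {x ∷ xs} (px ∷ pxs) = subst (AllPairs (flip R)) (sym (unfold-reverse x xs))
  (AllPairs.++⁺ (reverse-AllPairs pxs) ([] ∷ []) (All.map (_∷ []) (reverse-All px)))

module _ (α : Chord n) (p : ℕ) (xs : List (HE n)) where

  MarkedMap : Set
  MarkedMap = Involutive α × numVertices α + 2 * p ≡ n + 1 × All (Min (σc α)) xs × AllPairs _<ᶠ_ xs

  isMarkedMap : Bool
  isMarkedMap = isChord α ∧ hasGenus α p ∧ all (isVMin α) xs ∧ strictlySorted xs

  marked-sound : T isMarkedMap → MarkedMap
  marked-sound t =
    let ch , t₁ = ∧-elim (isChord α) t
        genus , t₂ = ∧-elim (hasGenus α p) t₁
        mins , sorted = ∧-elim (all (isVMin α) xs) t₂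
        iα = isChord⇒Involutive α ch
    in iα , ≡ᵇ⇒≡ _ _ genus
          , All.map (λ {h} → isMin⇒Min (σ-inj iα) h) (all⁺ (isVMin α) xs mins)
          , Linked⇒AllPairs <-trans (strictlySorted⇒Linked xs sorted)

  marked-complete : MarkedMap → T isMarkedMap
  marked-complete (iα , genus , mins , sorted) =
    ∧-intro {isChord α} (Involutive⇒isChord iα)
      (∧-intro {hasGenus α p} (≡⇒≡ᵇ _ _ genus)
        (∧-intro {all (isVMin α) xs} (all⁻ (isVMin α) (All.map (λ {h} → Min⇒isMin {h = h}) mins))
          (Linked⇒strictlySorted (AllPairs⇒Linked sorted))))

module _ (α : Chord n) (g : ℕ) (τ : HE n) where

  Trisected : Set
  Trisected = Involutive α × numVertices α + 2 * g ≡ n + 1 × toℕ (σc α τ) ≤ toℕ τ × ¬ Min (σc α) (σc α τ)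

  trisected-sound : IsD g n (α , τ) → Trisected
  trisected-sound t =
    let ch , t₁ = ∧-elim (isChord α) t
        genus , t₂ = ∧-elim (hasGenus α g) t₁
        le , ne = ∧-elim (toℕ (σc α τ) ≤ᵇ toℕ τ) t₂
        iα = isChord⇒Involutive α ch
    in iα , ≡ᵇ⇒≡ _ _ genus , ≤ᵇ⇒≤ _ _ le
          , λ m → T-not ne (≡⇒== (sym (vmin-unique (σ-inj iα) m (1 , refl))))

  trisected-complete : Trisected → IsD g n (α , τ)
  trisected-complete (iα , genus , le , ¬m) =
    ∧-intro {isChord α} (Involutive⇒isChord iα)
      (∧-intro {hasGenus α g} (≡⇒≡ᵇ _ _ genus)
        (∧-intro {toℕ (σc α τ) ≤ᵇ toℕ τ} (≤⇒≤ᵇ le)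
          (not-T λ e → ¬m (subst (Min (σc α)) (sym (==⇒≡ (σc α τ) (vmin toℕ (σc α) τ) e)) (vmin-Min (σ-inj iα) τ)))))

-- From marked maps to chains

start-good : {α : Chord n} {c : HE n} {vs : List (HE n)} → Involutive α →
  All (Min (σc α)) (c ∷ vs) → AllPairs (flip _<ᶠ_) (c ∷ vs) → Good α vs c
start-good {α = α} {c} iα (c-Min ∷ mins) (lower ∷ sorted) = record
  { chordal = iα ; minima = mins ; sorted = sorted
  ; below = All.map (λ {w} → below-c {w}) lower
  -- A vertex minimum cannot exceed its predecessor, which lies in the same vertex.
  ; desc = let τ , eq = Orbit.preimage (σ-inj iα) c
           in τ , eq , c-Min (Orbit.reach-sym (σ-inj iα) (1 , eq)) }
  where
  below-c : ∀ {w} → toℕ w < toℕ c → Below (σc α) w c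
  below-c lt r = <-≤-trans lt (c-Min r)

record Start (g p : ℕ) {k : ℕ} (α : Chord n) (ws : Vec (HE n) (suc k)) : Set where
  field
    c        : HE n
    vs       : List (HE n)
    rev      : reverse (toList ws) ≡ c ∷ vs
    good     : Good α vs c
    c-Min    : Min (σc α) c
    genus    : numVertices α + 2 * p ≡ n + 1
    size     : length vs ≡ 2 * (g ∸ p)
    computes : Computes (α , vs , c) (ΛRaw α ws)

-- Here `m` is `g - p - 1`: three vertices go to Φ, and each of the `m` applications of Ψ takes a
-- further pair.
split₃ : ∀ m (xs : List E) → length xs ≡ suc (2 * suc m) →
  ∃ λ c → ∃ λ b → ∃ λ a → ∃ λ rest → xs ≡ c ∷ b ∷ a ∷ rest × length rest ≡ m * 2
split₃ m (c ∷ b ∷ a ∷ rest) eq = c , b , a , rest , refl ,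
  suc-injective (suc-injective (suc-injective (trans eq (cong suc (*-comm 2 (suc m))))))
split₃ m (c ∷ b ∷ []) eq with trans (suc-injective eq) (*-comm 2 (suc m))
... | ()
split₃ m (c ∷ []) eq with suc-injective eq
... | ()

start : ∀ {g p} → p < g → (α : Chord n) (ws : Vec (HE n) (suc (2 * (g ∸ p)))) →
        T (isMarkedMap α p (toList ws)) → Start g p α ws
start {n} {g} {p} p<g α ws t = go (m<n⇒0<n∸m p<g) refl
  where
  marked = marked-sound α p (toList ws) t
  len : length (reverse (toList ws)) ≡ suc (2 * (g ∸ p))
  len = trans (length-reverse (toList ws)) (length-toList ws)
  mins : All (Min (σc α)) (reverse (toList ws))
  mins = reverse-All (proj₁ (proj₂ (proj₂ marked)))
  sorted′ : AllPairs (flip _<ᶠ_) (reverse (toList ws))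
  sorted′ = reverse-AllPairs (proj₂ (proj₂ (proj₂ marked)))
  go : ∀ {m} → 0 < m → g ∸ p ≡ m → Start g p α ws
  go {suc m} _ e =
    let c , b , a , rest , rev , len′ = split₃ m (reverse (toList ws)) (trans len (cong (λ z → suc (2 * z)) e))
        c-Min = All.head (subst (All (Min (σc α))) rev mins)
        good = start-good (proj₁ marked) (subst (All (Min (σc α))) rev mins) (subst (AllPairs (flip _<ᶠ_)) rev sorted′)
    in record
      { c = c ; vs = b ∷ a ∷ rest ; rev = rev ; good = good ; c-Min = c-Min
      ; genus = proj₁ (proj₂ marked)
      ; size = suc-injective (trans (sym (cong length rev)) len)
      ; computes = ΛRaw-computes m α ws rev len′ good c-Min }

length-double : ∀ {v w l m p g} → p ≤ g → v + 2 * p ≡ m → w + 2 * g ≡ m → v ≡ l + w → l ≡ 2 * (g ∸ p)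
length-double {w = w} {l} {p = p} {g} p≤g refl e refl = +-cancelʳ-≡ (2 * p) l (2 * (g ∸ p)) (begin
  l + 2 * p                     ≡⟨ +-cancelˡ-≡ w _ _ (trans (sym (trans (cong (_+ 2 * p) (+-comm l w)) (+-assoc w l (2 * p)))) (sym e)) ⟩
  2 * g                         ≡⟨ cong (2 *_) (m∸n+n≡m p≤g) ⟨
  2 * (g ∸ p + p)               ≡⟨ *-distribˡ-+ 2 (g ∸ p) p ⟩
  2 * (g ∸ p) + 2 * p           ∎)
  where open ≡-Reasoning

genus-final : ∀ {v w l m p g} → p ≤ g → v + 2 * p ≡ m → v ≡ l + w → l ≡ 2 * (g ∸ p) → w + 2 * g ≡ m
genus-final {w = w} {p = p} {g} p≤g refl refl refl = begin
  w + 2 * g                             ≡⟨ cong (λ z → w + 2 * z) (m∸n+n≡m p≤g) ⟨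
  w + 2 * (g ∸ p + p)                   ≡⟨ cong (w +_) (*-distribˡ-+ 2 (g ∸ p) p) ⟩
  w + (2 * (g ∸ p) + 2 * p)             ≡⟨ +-assoc w _ _ ⟨
  w + 2 * (g ∸ p) + 2 * p               ≡⟨ cong (_+ 2 * p) (+-comm w _) ⟩
  2 * (g ∸ p) + w + 2 * p               ∎
  where open ≡-Reasoning

computes-trisected : ∀ {g p} {α : Chord n} {vs c} (out : Chord n × HE n) → p ≤ g → Good α vs c →
  numVertices α + 2 * p ≡ n + 1 → length vs ≡ 2 * (g ∸ p) → Computes (α , vs , c) out → IsD g n out
computes-trisected {g = g} (β , τ) p≤g good genus size (c′ , run , ¬m , refl) =
  trisected-complete β g τ
    ( chordal good′ , genus-final p≤g genus (run-vertices good run) size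
    , subst (λ z → toℕ (σc β τ) ≤ toℕ z)
        (σ-inj (chordal good′) (proj₁ (proj₂ (desc good′)))) (proj₂ (proj₂ (desc good′)))
    , ¬m )
  where good′ = run-good good run

computes-injective : {S S₂ : State n} {out : Chord n × HE n} → GoodState S → GoodState S₂ →
  Min (σc (proj₁ S)) (proj₂ (proj₂ S)) → Min (σc (proj₁ S₂)) (proj₂ (proj₂ S₂)) →
  Computes S out → Computes S₂ out → S ≡ S₂
computes-injective good good₂ m m₂ (_ , run , _ , refl) (_ , run₂ , _ , refl)
  with run-comparable good good₂ run run₂
... | inj₁ r = run-to-Min good r m₂
... | inj₂ r = sym (run-to-Min good₂ r m)

computes-run : {S : State n} {β : Chord n} {τ : HE n} (out : Chord n × HE n) → Involutive β →
  Computes S out → Run S (β , [] , σc β τ) → out ≡ (β , τ)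
computes-run (β₂ , τ₂) iβ (_ , run , _ , refl) run₂ with run-deterministic run run₂
... | refl , e = cong (β₂ ,_) (σ-inj iβ e)

U-≡ : ∀ {k p} {α α₂ : Chord n} {ws ws₂ : Vec (HE n) k}
  {t : T (isMarkedMap α p (toList ws))} {t₂ : T (isMarkedMap α₂ p (toList ws₂))} →
  α ≡ α₂ → toList ws ≡ toList ws₂ → _≡_ {A = U k p n} (α , ws , t) (α₂ , ws₂ , t₂)
U-≡ {ws = ws} {ws₂} {t} {t₂} refl e with trans (sym (cast-is-id refl ws)) (toList-injective refl ws ws₂ e)
... | refl = cong (λ t → _ , ws , t) (T-irrelevant t t₂)

D-≡ : ∀ {g} {x y : Chord n × HE n} {dx : IsD g n x} {dy : IsD g n y} → x ≡ y → _≡_ {A = D g n} (x , dx) (y , dy)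
D-≡ {x = x} {dx = dx} {dy} refl = cong (x ,_) (T-irrelevant dx dy)

to-Vec : ∀ {k} (xs : List E) → length xs ≡ k → ∃ λ (v : Vec E k) → toList v ≡ xs
to-Vec xs refl = fromList xs , toList∘fromList xs

-- Bijectivity

module _ (g n : ℕ) where

  dom-start : ((p , α , ws , _) : Dom g n) → Start g (toℕ p) α ws
  dom-start (p , α , ws , t) = start (toℕ<n p) α ws t

  Λ-trisected : (x : Dom g n) → IsD g n (Λ g n x)
  Λ-trisected x@(p , _) = computes-trisected (Λ g n x) (<⇒≤ (toℕ<n p)) good genus size computes
    where open Start (dom-start x)

  dom-state : Dom g n → State n
  dom-state x@(_ , α , _) = α , Start.vs (dom-start x) , Start.c (dom-start x)

  dom-≡ : (x x₂ : Dom g n) → dom-state x ≡ dom-state x₂ → x ≡ x₂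
  dom-≡ x@(p , α , ws , t) x₂@(p₂ , α₂ , ws₂ , t₂) e = combine p≡ (cong proj₁ e) lists
    where
    module S = Start (dom-start x)
    module S₂ = Start (dom-start x₂)
    lists : toList ws ≡ toList ws₂
    lists = reverse-injective (trans S.rev (trans (cong (λ (_ , vs , c) → c ∷ vs) e) (sym S₂.rev)))
    -- The vertex count of `α` determines its genus, so injectivity holds across the summands of the
    -- union.
    p≡ : p ≡ p₂
    p≡ = toℕ-injective (*-cancelˡ-≡ _ _ 2 (+-cancelˡ-≡ (numVertices α) _ _
           (trans S.genus (trans (sym S₂.genus) (cong (λ z → numVertices z + 2 * toℕ p₂) (sym (cong proj₁ e)))))))
    combine : ∀ {p p₂ α α₂ ws ws₂ t t₂} → p ≡ p₂ → α ≡ α₂ → toList ws ≡ toList ws₂ →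
              _≡_ {A = Dom g n} (p , α , ws , t) (p₂ , α₂ , ws₂ , t₂)
    combine {p} {t = t} {t₂} refl e e′ = cong (p ,_) (U-≡ {p = toℕ p} {t = t} {t₂} e e′)

  Λ-injective : {x x₂ : Dom g n} → Λ g n x ≡ Λ g n x₂ → x ≡ x₂
  Λ-injective {x} {x₂} e = dom-≡ x x₂ (computes-injective S.good S₂.good S.c-Min S₂.c-Min
      S.computes (subst (Computes _) (sym e) S₂.computes))
    where
    module S = Start (dom-start x)
    module S₂ = Start (dom-start x₂)

  Λ-surjective : (y : Chord n × HE n) → IsD g n y → ∃ λ (x : Dom g n) → Λ g n x ≡ y
  Λ-surjective (β , τ) d =
    let iβ , genus , le , ¬m = trisected-sound β g τ d
        good′ = record { chordal = iβ ; minima = [] ; sorted = [] ; below = [] ; desc = τ , refl , le }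
        p , p<g , α , vs , c , run , good , c-Min , genus′ = slice-all g good′ ¬m genus
    -- The vertex counts at the two ends of the run give the length of `vs`, namely the number of
    -- distinguished vertices required besides `c`.
    in build iβ p<g run good c-Min genus′ (length-double (<⇒≤ p<g) genus′ genus (run-vertices good run))
    where
    build : ∀ {p α vs c} → Involutive β → p < g → Run (α , vs , c) (β , [] , σc β τ) → Good α vs c →
      Min (σc α) c → numVertices α + 2 * p ≡ n + 1 → length vs ≡ 2 * (g ∸ p) → ∃ λ (x : Dom g n) → Λ g n x ≡ (β , τ)
    build {p} {α} {vs} {c} iβ p<g run good c-Min genus size = x , out
      where
      q = fromℕ< p<g
      q≡ : toℕ q ≡ p
      q≡ = toℕ-fromℕ< p<g
      vec : ∃ λ (ws : Vec (HE n) (suc (2 * (g ∸ toℕ q)))) → toList ws ≡ reverse (c ∷ vs)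
      vec = to-Vec (reverse (c ∷ vs)) (trans (length-reverse (c ∷ vs)) (cong suc (trans size (cong (λ z → 2 * (g ∸ z)) (sym q≡)))))
      ws = proj₁ vec
      marked : MarkedMap α (toℕ q) (toList ws)
      marked = chordal good , trans (cong (λ z → numVertices α + 2 * z) q≡) genus
             , subst (All (Min (σc α))) (sym (proj₂ vec)) (reverse-All ((λ {_} → c-Min) ∷ minima good))
             , subst (AllPairs _<ᶠ_) (sym (proj₂ vec)) (reverse-AllPairs (All.map (λ {w} → lower {w}) (below good) ∷ sorted good))
        where
        lower : ∀ {w} → Below (σc α) w c → toℕ w < toℕ c
        lower b = b reach-refl
      x : Dom g n
      x = q , α , ws , marked-complete α (toℕ q) (toList ws) marked
      module S = Start (dom-start x)
      same : S.c ∷ S.vs ≡ c ∷ vs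
      same = trans (sym S.rev) (trans (cong reverse (proj₂ vec)) (reverse-involutive (c ∷ vs)))
      out : Λ g n x ≡ (β , τ)
      -- The run performed by Λ and the one found by slicing start at the same state, hence end at
      -- the same `β` and `c′`; injectivity of σ then returns `τ`.
      out = computes-run (Λ g n x) iβ S.computes
        (subst₂ (λ c vs → Run (α , vs , c) (β , [] , σc β τ))
          (sym (proj₁ (∷-injective same))) (sym (proj₂ (∷-injective same))) run)

theorem1 : (g n : ℕ) → 1 ≤ g → 1 ≤ n →
    Σ ((x : Dom g n) → IsD g n (Λ g n x)) λ ok →
    Bijective {A = Dom g n} {B = D g n} _≡_ _≡_ (λ x → Λ g n x , ok x)
theorem1 g n _ _ = Λ-trisected g n ,
  (λ e → Λ-injective g n (cong proj₁ e)) ,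
  λ (y , d) → let x , e = Λ-surjective g n y d in x , λ { refl → D-≡ {g = g} e }
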